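{- Let $m$ be a positive integer and $p$ a prime with $p>m$. Write $p=qm+r$ with $q=\lfloor p/m\rfloor$ and $0\le r<m$, write $\Phi_m=\sum_s a_sx^s$, and let $\Psi_m=(x^m-1)/\Phi_m$. Define $f_{m,p,i}$ ($0\le i\le\varphi(m)-1$) and $f_{m,p,i,j}$ ($0\le j\le q$) by $$\Phi_{mp}=\sum_{i=0}^{\varphi(m)-1}f_{m,p,i}\,x^{ip},\ \deg f_{m,p,i}<p,\qquad f_{m,p,i}=\sum_{j=0}^{q}f_{m,p,i,j}\,x^{jm},\ \deg f_{m,p,i,j}<m.$$ For $0\le i\le\varphi(m)-1$ let $w_i(x)=-\sum_{s=0}^{i}a_sx^{i-s}$ and $\Theta_i=\operatorname{rem}\bigl(w_i(x^{m-r}),\Phi_m\bigr)$. Then for every $0\le i\le\varphi(m)-1$, $$f_{m,p,i,0}=\Theta_i\,\Psi_m.$$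
   Context: $\Phi_n$ is the $n$-th cyclotomic polynomial, $\varphi$ is Euler's totient function, $\operatorname{rem}(a,b)$ is the remainder of polynomial division of $a$ by $b$, and $\Psi_m=(x^m-1)/\Phi_m$ is the $m$-th inverse cyclotomic polynomial. -}

module Defs where

open import Data.Nat using (ℕ; zero; suc; _+_; _*_; _∸_; NonZero)
open import Data.Nat.DivMod using (_%_)
open import Data.Nat.GCD using (gcd)
open import Data.Nat.Divisibility using (_∣?_)
import Data.Nat as ℕ
open import Data.Integer as ℤ using (ℤ; +_; -_)
open import Data.List using (List; []; _∷_; _++_; [_]; map; foldr; length; filter; replicate; lookup)
open import Data.List.Base using (upTo)
open import Data.Bool using (Bool; true; false; if_then_else_)
open import Data.Product using (_×_; _,_; proj₁; proj₂)
open import Relation.Nullary.Decidable using (isYes; does)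
open import Relation.Binary.PropositionalEquality using (_≡_)

-- Polynomials over ℤ as coefficient lists, lowest degree first.
-- Trailing zeros are allowed; equality is coefficientwise (_≈ₚ_).
Poly : Set
Poly = List ℤ

coeff : Poly → ℕ → ℤ
coeff []       _       = + 0
coeff (c ∷ _)  zero    = c
coeff (_ ∷ cs) (suc k) = coeff cs k

infix 4 _≈ₚ_
_≈ₚ_ : Poly → Poly → Set
a ≈ₚ b = ∀ k → coeff a k ≡ coeff b k

infixl 6 _+ₚ_ _-ₚ_
infixl 7 _*ₚ_

_+ₚ_ : Poly → Poly → Poly
[]       +ₚ q        = q
(a ∷ p)  +ₚ []       = a ∷ p
(a ∷ p)  +ₚ (b ∷ q)  = (a ℤ.+ b) ∷ (p +ₚ q)

negₚ : Poly → Poly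
negₚ = map -_

_-ₚ_ : Poly → Poly → Poly
p -ₚ q = p +ₚ negₚ q

scaleₚ : ℤ → Poly → Poly
scaleₚ c = map (c ℤ.*_)

_*ₚ_ : Poly → Poly → Poly
[]      *ₚ q = []
(a ∷ p) *ₚ q = scaleₚ a q +ₚ (+ 0 ∷ (p *ₚ q))

xpow : ℕ → Poly
xpow n = replicate n (+ 0) ++ [ + 1 ]

one : Poly
one = [ + 1 ]

xpow-1 : ℕ → Poly
xpow-1 n = xpow n -ₚ one

normalize : Poly → Poly
normalize = foldr step []
  where
  step : ℤ → Poly → Poly
  step c [] = if does (c ℤ.≟ + 0) then [] else [ c ]
  step c (d ∷ ds) = c ∷ d ∷ ds

deg : Poly → ℕ
deg p = length (normalize p) ∸ 1

-- Long division by a monic polynomial b: returns (quotient , remainder)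
-- with a = quotient * b + remainder and deg remainder < deg b.
divMonic : Poly → Poly → Poly × Poly
divMonic a b = go (length a) a
  where
  d = deg b
  go : ℕ → Poly → Poly × Poly
  go zero    a' = [] , a'
  go (suc n) a' =
    let c  = coeff a' (d + n)
        qr = go n (a' -ₚ scaleₚ c (xpow n *ₚ b))
    in (proj₁ qr +ₚ scaleₚ c (xpow n)) , proj₂ qr

quotₚ : Poly → Poly → Poly
quotₚ a b = proj₁ (divMonic a b)

remₚ : Poly → Poly → Poly
remₚ a b = proj₂ (divMonic a b)

prodₚ : List Poly → Poly
prodₚ = foldr _*ₚ_ one

-- table n = [Φ_1, …, Φ_n], via x^k - 1 = ∏_{d ∣ k} Φ_d, i.e.
-- Φ_k = (x^k - 1) / ∏_{d ∣ k, d < k} Φ_d  (exact division by a monic polynomial)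
cycloTable : ℕ → List Poly
cycloTable zero    = []
cycloTable (suc n) =
  let t = cycloTable n
      divs = filter (λ d → suc d ∣? suc n) (upTo n)
  in t ++ [ quotₚ (xpow-1 (suc n)) (prodₚ (map (λ d → nth t d) divs)) ]
  where
  nth : List Poly → ℕ → Poly
  nth []       _       = one
  nth (x ∷ _)  zero    = x
  nth (_ ∷ xs) (suc k) = nth xs k

-- n-th cyclotomic polynomial Φ_n (n ≥ 1); Φ_0 := 1 is an unused convention
Φ : ℕ → Poly
Φ zero    = one
Φ (suc n) = last' (cycloTable (suc n))
  where
  last' : List Poly → Poly
  last' []       = one
  last' (x ∷ []) = x
  last' (_ ∷ y ∷ ys) = last' (y ∷ ys)

Ψ : ℕ → Poly
Ψ m = quotₚ (xpow-1 m) (Φ m)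

totient : ℕ → ℕ
totient m = length (filter (λ k → gcd k m ℕ.≟ 1) (map suc (upTo m)))

slice : ℕ → ℕ → Poly → Poly
slice off len p = map (λ k → coeff p (off + k)) (upTo len)

-- f_{m,p,i}: Φ_{mp} = Σ_i f_{m,p,i} x^{ip}, deg f_{m,p,i} < p
f : ℕ → ℕ → ℕ → Poly
f m p i = slice (i * p) p (Φ (m * p))

-- f_{m,p,i,j}: f_{m,p,i} = Σ_j f_{m,p,i,j} x^{jm}, deg f_{m,p,i,j} < m
fij : ℕ → ℕ → ℕ → ℕ → Poly
fij m p i j = slice (j * m) m (f m p i)

substPow : ℕ → Poly → Poly
substPow e []      = []
substPow e (c ∷ p) = [ c ] +ₚ (xpow e *ₚ substPow e p)

w : ℕ → ℕ → Poly
w m i = negₚ (map (λ t → coeff (Φ m) (i ∸ t)) (upTo (suc i)))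

Θ : (m p i : ℕ) → .{{NonZero m}} → Poly
Θ m p i = remₚ (substPow (m ∸ (p % m)) (w m i)) (Φ m)

{-# OPTIONS --safe #-}

-- From Φ_mp(x) Φ_m(x) = Φ_m(x^p) and x^m − 1 = Φ_m Ψ_m one gets
-- Φ_mp · (x^m − 1) = Φ_m(x^p) Ψ_m.  Cutting this at degree ip + m shows that, modulo x^m − 1,
-- x^{ip} f_{m,p,i,0} is −Ψ_m times the part of Φ_m(x^p) of degree ≤ ip, and this part is congruent to
-- −x^{ip} w_i(x^{m−r}) because x^{m−r} inverts x^p.  Modulo x^m − 1, multiplying by Ψ_m only sees
-- w_i(x^{m−r}) modulo Φ_m, and both sides have degree < m.
--
-- That the recursive quotients defining Φ_n are exact is proved without roots of unity: for c < n
-- the ideal (Φ_n, Φ_c) of ℤ[x] contains the nonzero integer n / gcd(c,n), and a monic polynomial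
-- dividing K·R with K a nonzero integer divides R.
module Submission where

open import Defs
open import Algebra.Bundles using (CommutativeRing)
open import Data.Bool.Base using (if_then_else_; true; false)
open import Data.Empty using (⊥-elim)
open import Data.Integer as ℤ using (ℤ; +_; -_)
import Data.Integer.Properties as ℤₚ
open import Data.Integer.Tactic.RingSolver using () renaming (solve-∀ to ℤ-solve-∀)
open import Data.List.Base using (List; []; _∷_; [_]; _++_; length; map; filter; upTo; applyUpTo; take; drop)
import Data.List.Properties as Listₚ
open import Data.List.Relation.Unary.All using (_∷_)
import Data.List.Relation.Unary.All.Properties as Allₚ
open import Data.Maybe.Base using (Maybe; just; nothing)
open import Data.Nat as ℕ using (ℕ; zero; suc; _<_; _≤_; z≤n; s≤s; NonZero)
open import Data.Nat.Coprimality using (Coprime; coprime-divisor)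
open import Data.Nat.Divisibility as ∣ using (_∣_; _∣?_; divides)
open import Data.Nat.DivMod using (_%_; _/_; m≡m%n+[m/n]*n; m%n<n)
open import Data.Nat.GCD using (gcd; gcd[m,n]∣m; gcd[m,n]∣n; gcd-GCD; gcd[m,n]≡0⇒m≡0; module Bézout)
open import Data.Nat.Induction using (<-rec)
open import Data.Nat.ListAction using (product)
open import Data.Nat.Primality using (Prime; prime⇒irreducible; prime⇒nonTrivial; prime⇒nonZero)
open import Data.Nat.Primality.Factorisation using (factorise)
import Data.Nat.Properties as ℕₚ
open import Data.Product using (_×_; _,_; proj₁; proj₂; ∃-syntax)
open import Data.Sum.Base using (_⊎_; inj₁; inj₂)
open import Function.Base using (_∘_; id)
open import Level using (0ℓ)
open import Relation.Binary.Definitions using (tri<; tri≈; tri>)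
open import Relation.Binary.PropositionalEquality using (_≡_; _≢_; refl; sym; trans; cong; cong₂; subst; module ≡-Reasoning)
import Relation.Binary.Reasoning.Setoid as SetoidReasoning
open import Relation.Binary.Structures using (IsEquivalence)
open import Relation.Nullary using (Dec; yes; no; does; ¬_; ¬?)
open import Relation.Unary using (Decidable)
open import Tactic.RingSolver using (solve-∀)
open import Tactic.RingSolver.Core.AlmostCommutativeRing using (AlmostCommutativeRing; fromCommutativeRing)

-- The ring ℤ[x]

-- `Φ` is given only as a table of division results, so that Φ_n is monic, divides x^n - 1 and has
-- positive degree are all theorems. Monicity and exactness need one strong induction: exactness at
-- n uses that the earlier Φ_d with d ∣ n are monic and pairwise coprime up to an integer. Φ_mp Φ_m
-- = Φ_m(x^p) is also reached without roots, by sorting the divisors of mp and cancelling monic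
-- products. The cut at degree ip + m is clean for two reasons. Since Φ_m has positive degree, deg
-- Ψ_m < m, so Ψ_m times the terms of Φ_m(x^p) up to degree ip stays below the cut. Since m < p, the
-- next possible term, of degree (i+1)p, lies beyond it. The same inequality gives p ∤ m, without
-- which the factor Φ_m would be missing from Φ_m(x^p). The congruence obtained carries a factor
-- x^{ip}, which can be removed because x is a unit modulo x^m - 1.

-- Wrapping _≈ₚ_ in a record lets Agda infer the two polynomials from the type of a proof.
infix 4 _≋_
record _≋_ (a b : Poly) : Set where
  constructor coeffwise
  field at : a ≈ₚ b
open _≋_

≋-isEquivalence : IsEquivalence _≋_
≋-isEquivalence = record
  { refl  = coeffwise λ _ → refl
  ; sym   = λ e → coeffwise λ k → sym (at e k)
  ; trans = λ e f → coeffwise λ k → trans (at e k) (at f k)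
  }

coeff-+ : ∀ a b k → coeff (a +ₚ b) k ≡ coeff a k ℤ.+ coeff b k
coeff-+ []      b       k       = sym (ℤₚ.+-identityˡ _)
coeff-+ (x ∷ a) []      k       = sym (ℤₚ.+-identityʳ _)
coeff-+ (x ∷ a) (y ∷ b) zero    = refl
coeff-+ (x ∷ a) (y ∷ b) (suc k) = coeff-+ a b k

coeff-neg : ∀ a k → coeff (negₚ a) k ≡ - coeff a k
coeff-neg []      k       = refl
coeff-neg (x ∷ a) zero    = refl
coeff-neg (x ∷ a) (suc k) = coeff-neg a k

coeff-- : ∀ a b k → coeff (a -ₚ b) k ≡ coeff a k ℤ.- coeff b k
coeff-- a b k = trans (coeff-+ a (negₚ b) k) (cong (ℤ._+_ (coeff a k)) (coeff-neg b k))

coeff-scale : ∀ c a k → coeff (scaleₚ c a) k ≡ c ℤ.* coeff a k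
coeff-scale c []      k       = sym (ℤₚ.*-zeroʳ c)
coeff-scale c (x ∷ a) zero    = refl
coeff-scale c (x ∷ a) (suc k) = coeff-scale c a k

coeff-*-zero : ∀ x a b → coeff ((x ∷ a) *ₚ b) 0 ≡ x ℤ.* coeff b 0
coeff-*-zero x a b = trans (coeff-+ (scaleₚ x b) _ 0)
  (trans (ℤₚ.+-identityʳ _) (coeff-scale x b 0))

coeff-*-suc : ∀ x a b k →
  coeff ((x ∷ a) *ₚ b) (suc k) ≡ x ℤ.* coeff b (suc k) ℤ.+ coeff (a *ₚ b) k
coeff-*-suc x a b k = trans (coeff-+ (scaleₚ x b) _ (suc k))
  (cong (ℤ._+ coeff (a *ₚ b) k) (coeff-scale x b (suc k)))

*-zeroʳ : ∀ a → a *ₚ [] ≈ₚ []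
*-zeroʳ []      k       = refl
*-zeroʳ (x ∷ a) zero    = refl
*-zeroʳ (x ∷ a) (suc k) = *-zeroʳ a k

-- Mirror image of `coeff-*-suc`: `_*ₚ_` recurses on its left argument only, and commutativity
-- follows by induction once the same recursion holds on the right.
*-∷ʳ-suc : ∀ a y b k →
  coeff (a *ₚ (y ∷ b)) (suc k) ≡ y ℤ.* coeff a (suc k) ℤ.+ coeff (a *ₚ b) k
*-∷ʳ-suc []      y b k       = sym (trans (ℤₚ.+-identityʳ _) (ℤₚ.*-zeroʳ y))
*-∷ʳ-suc (x ∷ a) y b zero    = trans (coeff-*-suc x a (y ∷ b) 0) (trans
  (cong (ℤ._+_ (x ℤ.* coeff b 0)) (head a)) (trans (ℤₚ.+-comm (x ℤ.* coeff b 0) (y ℤ.* coeff a 0))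
  (cong (ℤ._+_ (y ℤ.* coeff a 0)) (sym (coeff-*-zero x a b)))))
  where
  head : ∀ a → coeff (a *ₚ (y ∷ b)) 0 ≡ y ℤ.* coeff a 0
  head []      = sym (ℤₚ.*-zeroʳ y)
  head (z ∷ a) = trans (coeff-*-zero z a (y ∷ b)) (ℤₚ.*-comm z y)
*-∷ʳ-suc (x ∷ a) y b (suc k) = trans (coeff-*-suc x a (y ∷ b) (suc k)) (trans
  (cong (ℤ._+_ (x ℤ.* coeff b (suc k))) (*-∷ʳ-suc a y b k))
  (trans (swap (x ℤ.* coeff b (suc k)) (y ℤ.* coeff a (suc k)) (coeff (a *ₚ b) k))
  (cong (ℤ._+_ (y ℤ.* coeff a (suc k))) (sym (coeff-*-suc x a b k)))))
  where
  swap : ∀ u v w → u ℤ.+ (v ℤ.+ w) ≡ v ℤ.+ (u ℤ.+ w)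
  swap = ℤ-solve-∀

*-comm : ∀ a b → a *ₚ b ≈ₚ b *ₚ a
*-comm []      b k             = sym (*-zeroʳ b k)
*-comm (x ∷ a) []      k       = *-zeroʳ (x ∷ a) k
*-comm (x ∷ a) (y ∷ b) zero    = trans (coeff-*-zero x a (y ∷ b))
  (trans (ℤₚ.*-comm x y) (sym (coeff-*-zero y b (x ∷ a))))
*-comm (x ∷ a) (y ∷ b) (suc k) = trans (coeff-*-suc x a (y ∷ b) k)
  (trans (cong (ℤ._+_ (x ℤ.* coeff b k)) (*-comm a (y ∷ b) k)) (sym (*-∷ʳ-suc (y ∷ b) x a k)))

*-congˡ : ∀ a {b c} → b ≈ₚ c → a *ₚ b ≈ₚ a *ₚ c
*-congˡ []      e k       = refl
*-congˡ (x ∷ a) {b} {c} e zero = trans (coeff-*-zero x a b)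
  (trans (cong (x ℤ.*_) (e 0)) (sym (coeff-*-zero x a c)))
*-congˡ (x ∷ a) {b} {c} e (suc k) = trans (coeff-*-suc x a b k)
  (trans (cong₂ ℤ._+_ (cong (x ℤ.*_) (e (suc k))) (*-congˡ a e k)) (sym (coeff-*-suc x a c k)))

*-distribˡ : ∀ a b c → a *ₚ (b +ₚ c) ≈ₚ a *ₚ b +ₚ a *ₚ c
*-distribˡ []      b c k       = refl
*-distribˡ (x ∷ a) b c zero    = trans (coeff-*-zero x a (b +ₚ c)) (trans
  (cong (x ℤ.*_) (coeff-+ b c 0)) (trans (ℤₚ.*-distribˡ-+ x _ _)
  (sym (trans (coeff-+ ((x ∷ a) *ₚ b) _ 0) (cong₂ ℤ._+_ (coeff-*-zero x a b) (coeff-*-zero x a c))))))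
*-distribˡ (x ∷ a) b c (suc k) = trans (coeff-*-suc x a (b +ₚ c) k) (trans
  (cong₂ (λ u v → x ℤ.* u ℤ.+ v) (coeff-+ b c (suc k))
    (trans (*-distribˡ a b c k) (coeff-+ (a *ₚ b) _ k)))
  (trans (rearrange x _ _ _ _)
  (sym (trans (coeff-+ ((x ∷ a) *ₚ b) _ (suc k))
    (cong₂ ℤ._+_ (coeff-*-suc x a b k) (coeff-*-suc x a c k))))))
  where
  rearrange : ∀ x u v s t → x ℤ.* (u ℤ.+ v) ℤ.+ (s ℤ.+ t) ≡ x ℤ.* u ℤ.+ s ℤ.+ (x ℤ.* v ℤ.+ t)
  rearrange = ℤ-solve-∀

+-congₚ : ∀ {a a′ b b′} → a ≋ a′ → b ≋ b′ → a +ₚ b ≋ a′ +ₚ b′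
+-congₚ {a} {a′} e f = coeffwise λ k →
  trans (coeff-+ a _ k) (trans (cong₂ ℤ._+_ (at e k) (at f k)) (sym (coeff-+ a′ _ k)))

*-distribʳ : ∀ a b c → (b +ₚ c) *ₚ a ≈ₚ b *ₚ a +ₚ c *ₚ a
*-distribʳ a b c k = trans (*-comm (b +ₚ c) a k) (trans (*-distribˡ a b c k)
  (at (+-congₚ {a *ₚ b} {b *ₚ a} {a *ₚ c} {c *ₚ a} (coeffwise (*-comm a b)) (coeffwise (*-comm a c))) k))

scale-* : ∀ x a b → scaleₚ x a *ₚ b ≈ₚ scaleₚ x (a *ₚ b)
scale-* x []      b k       = refl
scale-* x (y ∷ a) b zero    = trans (coeff-*-zero (x ℤ.* y) (scaleₚ x a) b) (trans (ℤₚ.*-assoc x y _)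
  (sym (trans (coeff-scale x ((y ∷ a) *ₚ b) 0) (cong (x ℤ.*_) (coeff-*-zero y a b)))))
scale-* x (y ∷ a) b (suc k) = trans (coeff-*-suc (x ℤ.* y) (scaleₚ x a) b k) (trans
  (cong (ℤ._+_ (x ℤ.* y ℤ.* coeff b (suc k))) (trans (scale-* x a b k) (coeff-scale x (a *ₚ b) k)))
  (trans (rearrange x y (coeff b (suc k)) (coeff (a *ₚ b) k))
  (sym (trans (coeff-scale x ((y ∷ a) *ₚ b) (suc k)) (cong (x ℤ.*_) (coeff-*-suc y a b k))))))
  where
  rearrange : ∀ x y u v → x ℤ.* y ℤ.* u ℤ.+ x ℤ.* v ≡ x ℤ.* (y ℤ.* u ℤ.+ v)
  rearrange = ℤ-solve-∀

shift-* : ∀ a b → (+ 0 ∷ a) *ₚ b ≈ₚ + 0 ∷ (a *ₚ b)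
shift-* a b zero    = coeff-*-zero (+ 0) a b
shift-* a b (suc k) = trans (coeff-*-suc (+ 0) a b k) (ℤₚ.+-identityˡ _)

*-assoc : ∀ a b c → (a *ₚ b) *ₚ c ≈ₚ a *ₚ (b *ₚ c)
*-assoc []      b c k = refl
*-assoc (x ∷ a) b c k = trans (*-distribʳ c (scaleₚ x b) _ k)
  (at (+-congₚ {scaleₚ x b *ₚ c} {scaleₚ x (b *ₚ c)} {(+ 0 ∷ (a *ₚ b)) *ₚ c} {+ 0 ∷ (a *ₚ (b *ₚ c))}
    (coeffwise (scale-* x b c)) (coeffwise shifted)) k)
  where
  shifted : (+ 0 ∷ (a *ₚ b)) *ₚ c ≈ₚ + 0 ∷ (a *ₚ (b *ₚ c))
  shifted zero    = shift-* (a *ₚ b) c 0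
  shifted (suc k) = trans (shift-* (a *ₚ b) c (suc k)) (*-assoc a b c k)

*-identityˡ : ∀ a → one *ₚ a ≈ₚ a
*-identityˡ a zero    = trans (coeff-*-zero (+ 1) [] a) (ℤₚ.*-identityˡ _)
*-identityˡ a (suc k) = trans (coeff-*-suc (+ 1) [] a k)
  (trans (ℤₚ.+-identityʳ _) (ℤₚ.*-identityˡ _))

ℤ[x] : CommutativeRing 0ℓ 0ℓ
ℤ[x] = record
  { Carrier = Poly ; _≈_ = _≋_ ; _+_ = _+ₚ_ ; _*_ = _*ₚ_ ; -_ = negₚ ; 0# = [] ; 1# = one
  ; isCommutativeRing = record
    { isRing = record
      { +-isAbelianGroup = record
        { isGroup = record
          { isMonoid = record
            { isSemigroup = record
              { isMagma = record { isEquivalence = ≋-isEquivalence ; ∙-cong = +-congₚ }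
              ; assoc = λ a b c → coeffwise λ k → +-assoc a b c k }
            ; identity = (λ _ → coeffwise λ _ → refl) , λ a → coeffwise λ k →
                trans (coeff-+ a [] k) (ℤₚ.+-identityʳ _) }
          ; inverse =
              (λ a → coeffwise λ k → trans (coeff-+ (negₚ a) a k)
                (trans (cong (ℤ._+ coeff a k) (coeff-neg a k)) (ℤₚ.+-inverseˡ (coeff a k))))
            , (λ a → coeffwise λ k → trans (coeff-- a a k) (ℤₚ.+-inverseʳ (coeff a k)))
          ; ⁻¹-cong = λ {a} {b} e → coeffwise λ k →
              trans (coeff-neg a k) (trans (cong -_ (at e k)) (sym (coeff-neg b k))) }
        ; comm = λ a b → coeffwise λ k →
            trans (coeff-+ a b k) (trans (ℤₚ.+-comm (coeff a k) _) (sym (coeff-+ b a k))) }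
      ; *-cong = λ {a} {a′} {b} {b′} e f → coeffwise λ k → trans (*-congˡ a (at f) k)
          (trans (*-comm a b′ k) (trans (*-congˡ b′ (at e) k) (*-comm b′ a′ k)))
      ; *-assoc = λ a b c → coeffwise (*-assoc a b c)
      ; *-identity = (λ a → coeffwise (*-identityˡ a)) , λ a → coeffwise λ k →
          trans (*-comm a one k) (*-identityˡ a k)
      ; distrib = (λ a b c → coeffwise (*-distribˡ a b c)) , λ a b c → coeffwise (*-distribʳ a b c)
      }
    ; *-comm = λ a b → coeffwise (*-comm a b)
    }
  }
  where
  +-assoc : ∀ a b c → (a +ₚ b) +ₚ c ≈ₚ a +ₚ (b +ₚ c)
  +-assoc a b c k = trans (coeff-+ (a +ₚ b) c k) (trans (cong (ℤ._+ coeff c k) (coeff-+ a b k))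
    (trans (ℤₚ.+-assoc (coeff a k) _ _)
    (sym (trans (coeff-+ a (b +ₚ c) k) (cong (λ t → coeff a k ℤ.+ t) (coeff-+ b c k))))))

open CommutativeRing ℤ[x]
  using (+-cong; *-cong; +-congˡ; +-congʳ; +-identityʳ; setoid; -‿cong)
  renaming (refl to ≋-refl; sym to ≋-sym; trans to ≋-trans)

-- Zero test for the ring solver. Answering `nothing` is always sound; it can only make the solver
-- miss a simplification.
isZero? : ∀ a → Maybe ([] ≋ a)
isZero? []      = just ≋-refl
isZero? (x ∷ a) with x ℤ.≟ + 0 | isZero? a
... | yes refl | just e = just (coeffwise λ { zero → refl ; (suc k) → at e k })
... | _        | _      = nothing

polyRing : AlmostCommutativeRing 0ℓ 0ℓ
polyRing = fromCommutativeRing ℤ[x] isZero?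

-- Degree and division by monic polynomials

module ≋-Reasoning = SetoidReasoning setoid

∷-cong : ∀ {x a b} → a ≋ b → x ∷ a ≋ x ∷ b
∷-cong e = coeffwise λ { zero → refl ; (suc k) → at e k }

xpow-suc-* : ∀ n a → xpow (suc n) *ₚ a ≋ + 0 ∷ (xpow n *ₚ a)
xpow-suc-* n a = coeffwise (shift-* (xpow n) a)

xpow-+ : ∀ m n → xpow (m ℕ.+ n) ≋ xpow m *ₚ xpow n
xpow-+ zero    n = ≋-sym (coeffwise (*-identityˡ (xpow n)))
xpow-+ (suc m) n = ≋-trans (∷-cong (xpow-+ m n)) (≋-sym (xpow-suc-* m (xpow n)))

coeff-xpow-* : ∀ n a k → coeff (xpow n *ₚ a) (n ℕ.+ k) ≡ coeff a k
coeff-xpow-* zero    a k = *-identityˡ a k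
coeff-xpow-* (suc n) a k = trans (at (xpow-suc-* n a) (suc (n ℕ.+ k))) (coeff-xpow-* n a k)

[]-* : ∀ c a → [ c ] *ₚ a ≋ scaleₚ c a
[]-* c a = coeffwise λ
  { zero    → trans (coeff-*-zero c [] a) (sym (coeff-scale c a 0))
  ; (suc k) → trans (coeff-*-suc c [] a k) (trans (ℤₚ.+-identityʳ _) (sym (coeff-scale c a (suc k)))) }

-- Degree bounds replace a degree function: they ignore trailing zeros and need no convention for
-- the zero polynomial.
Below : ℕ → Poly → Set
Below n a = ∀ k → n ≤ k → coeff a k ≡ + 0

record Monic (d : ℕ) (a : Poly) : Set where
  constructor monic
  field
    degree  : Below (suc d) a
    leading : coeff a d ≡ + 1
open Monic

Below-cong : ∀ {n a b} → a ≋ b → Below n a → Below n b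
Below-cong e h k n≤k = trans (sym (at e k)) (h k n≤k)

Below-mono : ∀ {m n a} → m ≤ n → Below m a → Below n a
Below-mono m≤n h k n≤k = h k (ℕₚ.≤-trans m≤n n≤k)

Below-0 : ∀ {a} → Below 0 a → a ≋ []
Below-0 h = coeffwise λ k → h k z≤n

Below-length : ∀ a → Below (length a) a
Below-length []      k       _       = refl
Below-length (x ∷ a) (suc k) (s≤s h) = Below-length a k h

Below-+ : ∀ {n} a b → Below n a → Below n b → Below n (a +ₚ b)
Below-+ a b h g k n≤k = trans (coeff-+ a b k) (cong₂ ℤ._+_ (h k n≤k) (g k n≤k))

Below-- : ∀ {n} a b → Below n a → Below n b → Below n (a -ₚ b)
Below-- a b h g k n≤k = trans (coeff-- a b k) (cong₂ ℤ._-_ (h k n≤k) (g k n≤k))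

*-zeroˡ-≋ : ∀ {a} b → a ≋ [] → a *ₚ b ≋ []
*-zeroˡ-≋ b e = *-cong e (≋-refl {b})

-- The bounds are deg a < n and deg b ≤ e; mixing strict and weak bounds keeps subtraction out of
-- deg(ab) < n + e and includes a = 0.
Below-* : ∀ {n e} a b → Below n a → Below (suc e) b → Below (n ℕ.+ e) (a *ₚ b)
Below-* {zero}  a       b h g k l = at (*-zeroˡ-≋ b (Below-0 {a} h)) k
Below-* {suc n} []      b h g k l = refl
Below-* {suc n} {e} (x ∷ a) b h g (suc k) (s≤s l) = trans (coeff-*-suc x a b k)
  (cong₂ ℤ._+_ (trans (cong (x ℤ.*_) (g (suc k) (s≤s (ℕₚ.m+n≤o⇒n≤o n l)))) (ℤₚ.*-zeroʳ x))
    (Below-* {n} a b (λ j n≤j → h (suc j) (s≤s n≤j)) g k l))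

coeff-*-top : ∀ {n e} a b → Below (suc n) a → Below (suc e) b →
  coeff (a *ₚ b) (n ℕ.+ e) ≡ coeff a n ℤ.* coeff b e
coeff-*-top []              b h g = refl
coeff-*-top {zero} {zero}  (x ∷ a) b h g = coeff-*-zero x a b
coeff-*-top {zero} {suc e} (x ∷ a) b h g = trans (coeff-*-suc x a b e)
  (trans (cong (ℤ._+_ (x ℤ.* coeff b (suc e)))
    (at (*-zeroˡ-≋ b (Below-0 {a} λ k _ → h (suc k) (s≤s z≤n))) e)) (ℤₚ.+-identityʳ _))
coeff-*-top {suc n} {e} (x ∷ a) b h g = trans (coeff-*-suc x a b (n ℕ.+ e))
  (trans (cong₂ ℤ._+_
    (trans (cong (x ℤ.*_) (g _ (s≤s (ℕₚ.m≤n+m e n)))) (ℤₚ.*-zeroʳ x))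
    (coeff-*-top a b (λ j n≤j → h (suc j) (s≤s n≤j)) g)) (ℤₚ.+-identityˡ _))

leadingTerm : ∀ a → a ≋ [] ⊎ (∃[ d ] (Below (suc d) a × coeff a d ≢ + 0))
leadingTerm [] = inj₁ ≋-refl
leadingTerm (x ∷ a) with leadingTerm a
... | inj₂ (d , h , ≢0) = inj₂ (suc d , (λ { (suc k) (s≤s l) → h k l }) , ≢0)
... | inj₁ e with x ℤ.≟ + 0
...   | yes refl = inj₁ (coeffwise λ { zero → refl ; (suc k) → at e k })
...   | no x≢0   = inj₂ (0 , (λ { (suc k) _ → at e k }) , x≢0)

coeff-*-Monic : ∀ {n d} a b → Below (suc n) a → Monic d b → coeff (a *ₚ b) (n ℕ.+ d) ≡ coeff a n
coeff-*-Monic {n} a b h mb = trans (coeff-*-top a b h (degree mb))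
  (trans (cong (coeff a n ℤ.*_) (leading mb)) (ℤₚ.*-identityʳ _))

-- The leading coefficient of a nonzero `t` of degree n reappears at n + d in the product, where the
-- bound forces 0. Cancellation, exact division and the final comparison of degrees all reduce to
-- this.
small-multiple-zero : ∀ {d b} t → Monic d b → Below d (t *ₚ b) → t ≋ []
small-multiple-zero {d} {b} t mb h with leadingTerm t
... | inj₁ e            = e
... | inj₂ (n , g , ≢0) = ⊥-elim
  (≢0 (trans (sym (coeff-*-Monic t b g mb)) (h (n ℕ.+ d) (ℕₚ.m≤n+m d n))))

≋⇒-≋0 : ∀ {a b} → a ≋ b → a -ₚ b ≋ []
≋⇒-≋0 {a} {b} e = coeffwise λ k → trans (coeff-- a b k)
  (trans (cong (ℤ._- coeff b k) (at e k)) (ℤₚ.+-inverseʳ (coeff b k)))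

-≋0⇒≋ : ∀ {a b} → a -ₚ b ≋ [] → a ≋ b
-≋0⇒≋ {a} {b} e = coeffwise λ k → ℤₚ.i-j≡0⇒i≡j _ _ (trans (sym (coeff-- a b k)) (at e k))

*-distribʳ-- : ∀ s t b → (s -ₚ t) *ₚ b ≋ s *ₚ b -ₚ t *ₚ b
*-distribʳ-- = solve-∀ polyRing

*-cancelʳ : ∀ {d b} s t → Monic d b → s *ₚ b ≋ t *ₚ b → s ≋ t
*-cancelʳ {b = b} s t mb e = -≋0⇒≋ (small-multiple-zero (s -ₚ t) mb
  (λ k _ → at (≋-trans (*-distribʳ-- s t b) (≋⇒-≋0 e)) k))

Monic-cong : ∀ {d a b} → a ≋ b → Monic d a → Monic d b
Monic-cong {d} {a} e m = monic (Below-cong {a = a} e (degree m)) (trans (sym (at e _)) (leading m))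

Monic-* : ∀ {d e} a b → Monic d a → Monic e b → Monic (d ℕ.+ e) (a *ₚ b)
Monic-* {d} a b ma mb = monic (Below-* {suc d} a b (degree ma) (degree mb))
  (trans (coeff-*-top a b (degree ma) (degree mb)) (cong₂ ℤ._*_ (leading ma) (leading mb)))

Monic-one : Monic 0 one
Monic-one = monic (λ { (suc k) _ → refl }) refl

Monic-<-Below : ∀ {d n a} → Monic d a → Below n a → d < n
Monic-<-Below {d} {n} ma h with d ℕₚ.<? n
... | yes d<n = d<n
... | no d≮n with () ← trans (sym (leading ma)) (h d (ℕₚ.≮⇒≥ d≮n))

Monic-unique : ∀ {d e a} → Monic d a → Monic e a → d ≡ e
Monic-unique {a = a} m m′ = ℕₚ.≤-antisym
  (ℕₚ.≤-pred (Monic-<-Below {a = a} m (degree m′))) (ℕₚ.≤-pred (Monic-<-Below {a = a} m′ (degree m)))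

-- Since `b` is monic, the leading coefficient of `a` is that of the product, at e + d; so e + d
-- must equal D. This is how Φ and Ψ are seen to be monic.
Monic-factor : ∀ {D d} a b → Monic D (a *ₚ b) → Monic d b → ∃[ e ] (e ℕ.+ d ≡ D × Monic e a)
Monic-factor {D} {d} a b mab mb with leadingTerm a
... | inj₁ z with () ← trans (sym (leading mab)) (at (*-zeroˡ-≋ b z) D)
... | inj₂ (e , h , ≢0) with ℕₚ.<-cmp (e ℕ.+ d) D
...   | tri< lt _ _   with () ← trans (sym (leading mab)) (Below-* {suc e} a b h (degree mb) D lt)
...   | tri> _ _ gt   = ⊥-elim (≢0 (trans (sym (coeff-*-Monic a b h mb)) (degree mab _ gt)))
...   | tri≈ _ refl _ = e , refl , monic h (trans (sym (coeff-*-Monic a b h mb)) (leading mab))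

normalize-zero : ∀ a → a ≋ [] → normalize a ≡ []
normalize-zero []      e = refl
normalize-zero (x ∷ a) e rewrite normalize-zero a (coeffwise λ k → at e (suc k)) | at e 0 = refl

length-normalize : ∀ {d} a → Monic d a → length (normalize a) ≡ suc d
length-normalize {d} []      (monic _ ())
length-normalize {zero} (x ∷ a) (monic h refl)
  rewrite normalize-zero a (coeffwise λ k → h (suc k) (s≤s z≤n)) = refl
length-normalize {suc d} (x ∷ a) (monic h l)
  with normalize a | length-normalize {d} a (monic (λ k le → h (suc k) (s≤s le)) l)
... | _ ∷ _ | e = cong suc e

deg-Monic : ∀ {d} a → Monic d a → deg a ≡ d
deg-Monic a m rewrite length-normalize a m = refl

IsDivision : ℕ → Poly → Poly → Poly × Poly → Set
IsDivision d b a qr = a ≋ proj₁ qr *ₚ b +ₚ proj₂ qr × Below d (proj₂ qr)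

-- divMonic recurses through a local function, which can only be named by unification.
mutual
  divLoop : ℤ → Poly → Poly → ℕ → Poly → Poly × Poly
  divLoop = _

  divLoop-correct : ∀ x a b n a′ → length a ≡ n →
    (x ∷ a) -ₚ scaleₚ (coeff (x ∷ a) (deg b ℕ.+ length a)) (xpow (length a) *ₚ b) ≡ a′ →
    divMonic (x ∷ a) b ≡
      ( proj₁ (divLoop x a b n a′) +ₚ scaleₚ (coeff (x ∷ a) (deg b ℕ.+ n)) (xpow n)
      , proj₂ (divLoop x a b n a′))
  divLoop-correct x a b n a′ e₁ e₂ rewrite e₂ | e₁ = refl

-- Position d + n cancels because `b` is monic; above it both terms vanish.
Below-reduce : ∀ {d b} n a → Monic d b → Below (d ℕ.+ suc n) a →
  Below (d ℕ.+ n) (a -ₚ scaleₚ (coeff a (d ℕ.+ n)) (xpow n *ₚ b))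
Below-reduce {d} {b} n a mb h k l with ℕₚ.m≤n⇒∃[o]m+o≡n l
... | j , refl = trans (coeff-- a (scaleₚ c (xpow n *ₚ b)) _) (trans
  (cong (ℤ._-_ (coeff a (d ℕ.+ n ℕ.+ j))) (trans (coeff-scale c (xpow n *ₚ b) _)
    (cong (c ℤ.*_) (trans (cong (coeff (xpow n *ₚ b)) (rearrange d n j)) (coeff-xpow-* n b (d ℕ.+ j))))))
  (go j))
  where
  c = coeff a (d ℕ.+ n)
  rearrange : ∀ d n j → d ℕ.+ n ℕ.+ j ≡ n ℕ.+ (d ℕ.+ j)
  rearrange d n j = trans (cong (ℕ._+ j) (ℕₚ.+-comm d n)) (ℕₚ.+-assoc n d j)
  go : ∀ j → coeff a (d ℕ.+ n ℕ.+ j) ℤ.- c ℤ.* coeff b (d ℕ.+ j) ≡ + 0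
  go zero rewrite ℕₚ.+-identityʳ (d ℕ.+ n) | ℕₚ.+-identityʳ d | leading mb | ℤₚ.*-identityʳ c =
    ℤₚ.+-inverseʳ c
  go (suc j) rewrite degree mb (d ℕ.+ suc j) (ℕₚ.m<m+n d (s≤s z≤n)) | ℤₚ.*-zeroʳ c =
    trans (ℤₚ.+-identityʳ _) (h _ (ℕₚ.≤-trans (ℕₚ.≤-reflexive (ℕₚ.+-suc d n))
      (ℕₚ.m<m+n (d ℕ.+ n) (s≤s z≤n))))

IsDivision-step : ∀ {d} n c a b qr → IsDivision d b (a -ₚ scaleₚ c (xpow n *ₚ b)) qr →
  IsDivision d b a (proj₁ qr +ₚ scaleₚ c (xpow n) , proj₂ qr)
IsDivision-step n c a b (q , r) (e , small) = (begin
  a                                              ≈⟨ add-back a s ⟩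
  (a -ₚ s) +ₚ s                                  ≈⟨ +-cong e (≋-refl {s}) ⟩
  (q *ₚ b +ₚ r) +ₚ s                             ≈⟨ +-congˡ {q *ₚ b +ₚ r} (coeffwise (λ k → sym (scale-* c (xpow n) b k))) ⟩
  (q *ₚ b +ₚ r) +ₚ scaleₚ c (xpow n) *ₚ b        ≈⟨ collect q b r (scaleₚ c (xpow n)) ⟩
  (q +ₚ scaleₚ c (xpow n)) *ₚ b +ₚ r             ∎) , small
  where
  open ≋-Reasoning
  s = scaleₚ c (xpow n *ₚ b)
  add-back : ∀ a s → a ≋ (a -ₚ s) +ₚ s
  add-back = solve-∀ polyRing
  collect : ∀ q b r s → (q *ₚ b +ₚ r) +ₚ s *ₚ b ≋ (q +ₚ s) *ₚ b +ₚ r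
  collect = solve-∀ polyRing

divLoop-spec : ∀ {d} x a b → Monic d b → ∀ n a′ → Below (d ℕ.+ n) a′ → IsDivision d b a′ (divLoop x a b n a′)
divLoop-spec {d} x a b mb zero    a′ h =
  ≋-refl , subst (λ n → Below n a′) (ℕₚ.+-identityʳ d) h
divLoop-spec {d} x a b mb (suc n) a′ h rewrite deg-Monic b mb =
  IsDivision-step n (coeff a′ (d ℕ.+ n)) a′ b (divLoop x a b n _)
    (divLoop-spec x a b mb n _ (Below-reduce n a′ mb h))

divMonic-spec : ∀ {d b} a → Monic d b → IsDivision d b a (divMonic a b)
divMonic-spec         []      mb = ≋-refl , λ _ _ → refl
divMonic-spec {d} {b} (x ∷ a) mb
  rewrite divLoop-correct x a b _ _ refl refl | deg-Monic b mb =
  IsDivision-step (length a) (coeff (x ∷ a) (d ℕ.+ length a)) (x ∷ a) b (divLoop x a b (length a) _)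
    (divLoop-spec x a b mb (length a) _ (Below-reduce (length a) (x ∷ a) mb
      (Below-mono {a = x ∷ a} (ℕₚ.m≤n+m (suc (length a)) d) (Below-length (x ∷ a)))))

infix 4 _∣ₚ_
_∣ₚ_ : Poly → Poly → Set
b ∣ₚ a = ∃[ q ] a ≋ q *ₚ b

-- If a = t b = q b + r, then (t - q) b = r is smaller than b, so t = q.
quotₚ-exact : ∀ {d b} a → Monic d b → b ∣ₚ a → a ≋ quotₚ a b *ₚ b
quotₚ-exact {d} {b} a mb (t , a≋tb) with divMonic-spec a mb
... | a≋qb+r , r-small = ≋-trans a≋tb (*-cong t≋q (≋-refl {b}))
  where
  q = quotₚ a b
  r = remₚ a b
  cancel : ∀ u r → (u +ₚ r) -ₚ u ≋ r
  cancel = solve-∀ polyRing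
  difference : (t -ₚ q) *ₚ b ≋ r
  difference = ≋-trans (*-distribʳ-- t q b) (≋-trans
    (+-cong (≋-trans (≋-sym a≋tb) a≋qb+r) (≋-refl {negₚ (q *ₚ b)})) (cancel (q *ₚ b) r))
  t≋q : t ≋ q
  t≋q = -≋0⇒≋ (small-multiple-zero (t -ₚ q) mb (Below-cong {a = r} (≋-sym difference) r-small))

-- Products over initial segments of ℕ

∏ : (ℕ → Poly) → ℕ → Poly
∏ g zero    = one
∏ g (suc n) = ∏ g n *ₚ g n

∏-cong : ∀ {g h} n → (∀ k → k < n → g k ≋ h k) → ∏ g n ≋ ∏ h n
∏-cong zero    e = ≋-refl
∏-cong (suc n) e = *-cong (∏-cong n (λ k k<n → e k (ℕₚ.m<n⇒m<1+n k<n))) (e n (ℕₚ.n<1+n n))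

∏-* : ∀ g h n → ∏ (λ k → g k *ₚ h k) n ≋ ∏ g n *ₚ ∏ h n
∏-* g h zero    = ≋-sym (coeffwise (*-identityˡ one))
∏-* g h (suc n) = ≋-trans (*-cong (∏-* g h n) (≋-refl {g n *ₚ h n})) (interchange (∏ g n) (∏ h n) (g n) (h n))
  where
  interchange : ∀ a b c d → (a *ₚ b) *ₚ (c *ₚ d) ≋ (a *ₚ c) *ₚ (b *ₚ d)
  interchange = solve-∀ polyRing

*-oneʳ : ∀ a {b} → b ≋ one → a *ₚ b ≋ a
*-oneʳ a e = ≋-trans (*-cong (≋-refl {a}) e) (coeffwise λ k → trans (*-comm a one k) (*-identityˡ a k))

*-oneˡ : ∀ {a} b → a ≋ one → a *ₚ b ≋ b
*-oneˡ b e = ≋-trans (*-cong e (≋-refl {b})) (coeffwise (*-identityˡ b))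

∏-+ : ∀ g m n → ∏ g (m ℕ.+ n) ≋ ∏ g m *ₚ ∏ (λ k → g (m ℕ.+ k)) n
∏-+ g m zero rewrite ℕₚ.+-identityʳ m = ≋-sym (*-oneʳ (∏ g m) ≋-refl)
∏-+ g m (suc n) rewrite ℕₚ.+-suc m n =
  ≋-trans (*-cong (∏-+ g m n) (≋-refl {g (m ℕ.+ n)})) (coeffwise (*-assoc (∏ g m) _ _))

∏-one : ∀ {g} n → (∀ k → k < n → g k ≋ one) → ∏ g n ≋ one
∏-one zero    e = ≋-refl
∏-one (suc n) e = ≋-trans (*-oneʳ _ (e n (ℕₚ.n<1+n n))) (∏-one n λ k k<n → e k (ℕₚ.m<n⇒m<1+n k<n))

∏-extend : ∀ {g m n} → m ≤ n → (∀ k → m ≤ k → g k ≋ one) → ∏ g n ≋ ∏ g m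
∏-extend {g} {m} m≤n e with ℕₚ.m≤n⇒∃[o]m+o≡n m≤n
... | o , refl = ≋-trans (∏-+ g m o) (*-oneʳ (∏ g m) (∏-one o λ k _ → e _ (ℕₚ.m≤m+n m k)))

∏-cons : ∀ g n → ∏ g (suc n) ≋ g 0 *ₚ ∏ (g ∘ suc) n
∏-cons g n = ≋-trans (∏-+ g 1 n)
  (*-cong (*-oneˡ (g 0) ≋-refl) (≋-refl {∏ (g ∘ suc) n}))

∏-Monic : ∀ {g} n → (∀ k → k < n → ∃[ d ] Monic d (g k)) → ∃[ d ] Monic d (∏ g n)
∏-Monic zero    h = 0 , Monic-one
∏-Monic {g} (suc n) h with ∏-Monic {g} n (λ k k<n → h k (ℕₚ.m<n⇒m<1+n k<n)) | h n (ℕₚ.n<1+n n)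
... | d , m | d′ , m′ = d ℕ.+ d′ , Monic-* _ _ m m′

-- In each block of `p` consecutive factors only the first can differ from `one`.
∏-multiples : ∀ {g} p n → (∀ e r → 0 < r → r < p → g (e ℕ.* p ℕ.+ r) ≋ one) → 0 < p →
  ∏ g (n ℕ.* p) ≋ ∏ (λ e → g (e ℕ.* p)) n
∏-multiples p zero h 0<p = ≋-refl
∏-multiples {g} p@(suc p′) (suc n) h 0<p = begin
  ∏ g (p ℕ.+ n ℕ.* p)                                       ≡⟨ cong (∏ g) (ℕₚ.+-comm p (n ℕ.* p)) ⟩
  ∏ g (n ℕ.* p ℕ.+ p)                                       ≈⟨ ∏-+ g (n ℕ.* p) p ⟩
  ∏ g (n ℕ.* p) *ₚ ∏ (λ k → g (n ℕ.* p ℕ.+ k)) p            ≈⟨ *-cong (∏-multiples p n h 0<p) block ⟩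
  ∏ (λ e → g (e ℕ.* p)) n *ₚ g (n ℕ.* p)                    ∎
  where
  open ≋-Reasoning
  block : ∏ (λ k → g (n ℕ.* p ℕ.+ k)) p ≋ g (n ℕ.* p)
  block = begin
    ∏ (λ k → g (n ℕ.* p ℕ.+ k)) p                           ≈⟨ ∏-cons (λ k → g (n ℕ.* p ℕ.+ k)) p′ ⟩
    g (n ℕ.* p ℕ.+ 0) *ₚ ∏ (λ k → g (n ℕ.* p ℕ.+ suc k)) p′ ≈⟨ *-oneʳ _ (∏-one p′ λ k k<p′ → h n (suc k) (s≤s z≤n) (s≤s k<p′)) ⟩
    g (n ℕ.* p ℕ.+ 0)                                       ≡⟨ cong g (ℕₚ.+-identityʳ (n ℕ.* p)) ⟩
    g (n ℕ.* p)                                             ∎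

infix 8 ⟦_⟧_
-- A conditional factor. It turns products over divisors into products over initial segments of ℕ,
-- which can be compared factor by factor.
⟦_⟧_ : ∀ {P : Set} → Dec P → Poly → Poly
⟦ P? ⟧ a = if does P? then a else one

⟦⟧-true : ∀ {P : Set} (P? : Dec P) {a} → P → ⟦ P? ⟧ a ≋ a
⟦⟧-true (yes _) _ = ≋-refl
⟦⟧-true (no ¬p) p = ⊥-elim (¬p p)

⟦⟧-false : ∀ {P : Set} (P? : Dec P) {a} → ¬ P → ⟦ P? ⟧ a ≋ one
⟦⟧-false (yes p) ¬p = ⊥-elim (¬p p)
⟦⟧-false (no _)  _  = ≋-refl

⟦⟧-one : ∀ {P : Set} (P? : Dec P) → ⟦ P? ⟧ one ≋ one
⟦⟧-one (yes _) = ≋-refl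
⟦⟧-one (no _)  = ≋-refl

⟦⟧-cong : ∀ {P : Set} (P? : Dec P) {a b} → (P → a ≋ b) → ⟦ P? ⟧ a ≋ ⟦ P? ⟧ b
⟦⟧-cong (yes p) e = e p
⟦⟧-cong (no _)  e = ≋-refl

⟦⟧-* : ∀ {P : Set} (P? : Dec P) a b → ⟦ P? ⟧ (a *ₚ b) ≋ ⟦ P? ⟧ a *ₚ ⟦ P? ⟧ b
⟦⟧-* (yes _) a b = ≋-refl
⟦⟧-* (no _)  a b = ≋-sym (coeffwise (*-identityˡ one))

⟦⟧-Monic : ∀ {P : Set} (P? : Dec P) {a} → (P → ∃[ d ] Monic d a) → ∃[ d ] Monic d (⟦ P? ⟧ a)
⟦⟧-Monic (yes p) h = h p
⟦⟧-Monic (no _)  h = 0 , Monic-one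

-- An arbitrary `f` is required by the induction: `upTo n` is `applyUpTo id n`, and its tail
-- involves `id ∘ suc`.
prodₚ-filter : ∀ {P : ℕ → Set} (P? : Decidable P) h f n →
  prodₚ (map h (filter P? (applyUpTo f n))) ≋ ∏ (λ k → ⟦ P? (f k) ⟧ h (f k)) n
prodₚ-filter P? h f zero = ≋-refl
prodₚ-filter P? h f (suc n) = ≋-trans step (≋-sym (∏-cons (λ k → ⟦ P? (f k) ⟧ h (f k)) n))
  where
  rest = ∏ (λ k → ⟦ P? (f (suc k)) ⟧ h (f (suc k))) n
  step : prodₚ (map h (filter P? (f 0 ∷ applyUpTo (f ∘ suc) n))) ≋ ⟦ P? (f 0) ⟧ h (f 0) *ₚ rest
  step with does (P? (f 0))
  ... | true  = *-cong (≋-refl {h (f 0)}) (prodₚ-filter P? h (f ∘ suc) n)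
  ... | false = ≋-trans (prodₚ-filter P? h (f ∘ suc) n) (≋-sym (*-oneˡ rest ≋-refl))

-- Unfolding the table of cyclotomic polynomials

-- Like divLoop, nth and last name local functions, those of cycloTable and Φ.
mutual
  nth : ℕ → List Poly → ℕ → Poly
  nth = _

  cycloTable-suc : ∀ n t → cycloTable n ≡ t → cycloTable (suc n) ≡
    t ++ [ quotₚ (xpow-1 (suc n)) (prodₚ (map (nth n t) (filter (λ d → suc d ∣? suc n) (upTo n)))) ]
  cycloTable-suc n t e rewrite e = refl

mutual
  last : ℕ → List Poly → Poly
  last = _

  Φ-last : ∀ n t → cycloTable (suc n) ≡ t → Φ (suc n) ≡ last n t
  Φ-last n t e rewrite e = refl

last-++ : ∀ n t a → last n (t ++ [ a ]) ≡ a
last-++ n []          a = refl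
last-++ n (x ∷ [])    a = refl
last-++ n (x ∷ y ∷ t) a = last-++ n (y ∷ t) a

nth-++-< : ∀ n t a {d} → d < length t → nth n (t ++ [ a ]) d ≡ nth n t d
nth-++-< n (x ∷ t) a {zero}  _       = refl
nth-++-< n (x ∷ t) a {suc d} (s≤s l) = nth-++-< n t a l

nth-++-length : ∀ n t a → nth n (t ++ [ a ]) (length t) ≡ a
nth-++-length n []      a = refl
nth-++-length n (x ∷ t) a = nth-++-length n t a

cycloTable-suc-Φ : ∀ n → cycloTable (suc n) ≡ cycloTable n ++ [ Φ (suc n) ]
cycloTable-suc-Φ n = trans (cycloTable-suc n _ refl) (cong (λ a → cycloTable n ++ [ a ])
  (sym (trans (Φ-last n _ (cycloTable-suc n _ refl)) (last-++ n (cycloTable n) _))))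

length-cycloTable : ∀ n → length (cycloTable n) ≡ n
length-cycloTable zero = refl
length-cycloTable (suc n) = trans (cong length (cycloTable-suc-Φ n)) (trans
  (Listₚ.length-++ (cycloTable n)) (trans (ℕₚ.+-comm _ 1) (cong suc (length-cycloTable n))))

-- Later stages only append to the table, so an entry never changes. `k` is the argument of the
-- clause in which the local function lives; it stays fixed while `n` decreases.
nth-cycloTable : ∀ k n d → d < n → nth k (cycloTable n) d ≡ Φ (suc d)
nth-cycloTable k (suc n) d d<1+n rewrite cycloTable-suc-Φ n with ℕₚ.m≤n⇒m<n∨m≡n (ℕₚ.≤-pred d<1+n)
... | inj₁ d<n  = trans (nth-++-< k (cycloTable n) _ (subst (d <_) (sym (length-cycloTable n)) d<n))
                    (nth-cycloTable k n d d<n)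
... | inj₂ refl = subst (λ l → nth k (cycloTable d ++ [ Φ (suc d) ]) l ≡ Φ (suc d))
                    (length-cycloTable d) (nth-++-length k (cycloTable d) _)

Φ-unfold : ∀ n → Φ (suc n) ≡
  quotₚ (xpow-1 (suc n)) (prodₚ (map (Φ ∘ suc) (filter (λ d → suc d ∣? suc n) (upTo n))))
Φ-unfold n = trans (Φ-last n _ (cycloTable-suc n _ refl)) (trans (last-++ n (cycloTable n) _)
  (cong (λ l → quotₚ (xpow-1 (suc n)) (prodₚ l)) (Listₚ.map-cong-local
    (Allₚ.filter⁺ (λ d → suc d ∣? suc n) (Allₚ.applyUpTo⁺₁ id n λ {d} d<n → nth-cycloTable n n d d<n)))))

Φ∣ : ℕ → ℕ → Poly
Φ∣ n d = ⟦ d ∣? n ⟧ Φ d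

∏Φ∣-proper : ∀ n → prodₚ (map (Φ ∘ suc) (filter (λ d → suc d ∣? suc n) (upTo n))) ≋ ∏ (Φ∣ (suc n)) (suc n)
∏Φ∣-proper n = ≋-trans (prodₚ-filter (λ d → suc d ∣? suc n) (Φ ∘ suc) id n)
  -- The table is shifted by one; the extra index 0 contributes `Φ 0`, which is `one`.
  (≋-sym (≋-trans (∏-cons (Φ∣ (suc n)) n) (*-oneˡ _ (⟦⟧-one (0 ∣? suc n)))))

-- Exactness of the quotients defining Φ

-- The statement carried through the strong induction: `factors` says that the quotient defining Φ_n
-- is exact, and `Φ-Monic` allows later divisions by Φ_n.
record Cyclotomic (n : ℕ) : Set where
  field
    {φ}   : ℕ
    Φ-Monic : Monic φ (Φ n)
    factors : xpow-1 n ≋ Φ n *ₚ ∏ (Φ∣ n) n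
open Cyclotomic

xpow-Monic : ∀ n → Monic n (xpow n)
xpow-Monic zero    = Monic-one
xpow-Monic (suc n) with xpow-Monic n
... | monic h l = monic (λ { (suc k) (s≤s le) → h k le }) l

xpow-1-Monic : ∀ n → 0 < n → Monic n (xpow-1 n)
xpow-1-Monic (suc n) _ = monic
  (Below-- (xpow (suc n)) one (degree (xpow-Monic (suc n))) λ { (suc k) _ → refl })
  (trans (coeff-- (xpow (suc n)) one (suc n)) (trans (ℤₚ.+-identityʳ _) (leading (xpow-Monic (suc n)))))

Φ∣->n : ∀ {n} → 0 < n → ∀ d → n < d → Φ∣ n d ≋ one
Φ∣->n {suc n} _ d n<d = ⟦⟧-false (d ∣? suc n) λ d∣n → ℕₚ.<⇒≱ n<d (∣.∣⇒≤ d∣n)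

∏Φ∣ : ∀ {n N} → Cyclotomic n → 0 < n → n < N → xpow-1 n ≋ ∏ (Φ∣ n) N
∏Φ∣ {n} {N} c 0<n n<N = ≋-trans (factors c) (≋-trans (coeffwise (*-comm (Φ n) _))
  (≋-trans (*-cong (≋-refl {∏ (Φ∣ n) n}) (≋-sym (⟦⟧-true (n ∣? n) ∣.∣-refl)))
  (≋-sym (∏-extend n<N (Φ∣->n 0<n)))))

geo : ℕ → ℕ → Poly
geo g zero    = []
geo g (suc k) = one +ₚ xpow g *ₚ geo g k

xpow-1-geo : ∀ g k → xpow-1 (k ℕ.* g) ≋ geo g k *ₚ xpow-1 g
xpow-1-geo g zero    = ≋⇒-≋0 {one} ≋-refl
xpow-1-geo g (suc k) = begin
  xpow (g ℕ.+ k ℕ.* g) -ₚ one                        ≈⟨ +-cong (xpow-+ g (k ℕ.* g)) ≋-refl ⟩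
  xpow g *ₚ xpow (k ℕ.* g) -ₚ one                    ≈⟨ split (xpow g) (xpow (k ℕ.* g)) ⟩
  xpow g *ₚ xpow-1 (k ℕ.* g) +ₚ (xpow g -ₚ one)      ≈⟨ +-cong (*-cong (≋-refl {xpow g}) (xpow-1-geo g k)) (≋-refl {xpow-1 g}) ⟩
  xpow g *ₚ (geo g k *ₚ xpow-1 g) +ₚ xpow-1 g        ≈⟨ collect (xpow g) (geo g k) (xpow-1 g) ⟩
  geo g (suc k) *ₚ xpow-1 g                          ∎
  where
  open ≋-Reasoning
  split : ∀ a b → a *ₚ b -ₚ one ≋ a *ₚ (b -ₚ one) +ₚ (a -ₚ one)
  split = solve-∀ polyRing
  collect : ∀ a b c → a *ₚ (b *ₚ c) +ₚ c ≋ (one +ₚ a *ₚ b) *ₚ c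
  collect = solve-∀ polyRing

xpow-1-∣ : ∀ {m n} → m ∣ n → xpow-1 m ∣ₚ xpow-1 n
xpow-1-∣ {m} (divides k refl) = geo m k , xpow-1-geo m k

-- Ideals with two generators, and coprimality up to an integer

infix 4 _∈⟨_,_⟩
_∈⟨_,_⟩ : Poly → Poly → Poly → Set
a ∈⟨ b , c ⟩ = ∃[ u ] ∃[ v ] a ≋ u *ₚ b +ₚ v *ₚ c

module _ {b c : Poly} where

  ∈-cong : ∀ {a a′} → a ≋ a′ → a ∈⟨ b , c ⟩ → a′ ∈⟨ b , c ⟩
  ∈-cong e (u , v , f) = u , v , ≋-trans (≋-sym e) f

  ∈-combine : ∀ {a a′} s t → a ∈⟨ b , c ⟩ → a′ ∈⟨ b , c ⟩ → s *ₚ a +ₚ t *ₚ a′ ∈⟨ b , c ⟩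
  ∈-combine s t (u , v , e) (u′ , v′ , e′) = s *ₚ u +ₚ t *ₚ u′ , s *ₚ v +ₚ t *ₚ v′ ,
    ≋-trans (+-cong (*-cong (≋-refl {s}) e) (*-cong (≋-refl {t}) e′)) (collect s t u v u′ v′ b c)
    where
    collect : ∀ s t u v u′ v′ b c → s *ₚ (u *ₚ b +ₚ v *ₚ c) +ₚ t *ₚ (u′ *ₚ b +ₚ v′ *ₚ c)
      ≋ (s *ₚ u +ₚ t *ₚ u′) *ₚ b +ₚ (s *ₚ v +ₚ t *ₚ v′) *ₚ c
    collect = solve-∀ polyRing

  ∈-left : ∀ {a} → b ∣ₚ a → a ∈⟨ b , c ⟩
  ∈-left {a} (q , e) = q , [] , ≋-trans e (≋-sym (+-identityʳ (q *ₚ b)))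

  ∈-right : ∀ {a} → c ∣ₚ a → a ∈⟨ b , c ⟩
  ∈-right {a} (q , e) = [] , q , e

  -- With X the variable, (X^{xm} - 1) - X^g (X^{yn} - 1) = X^g - 1 because xm = g + yn. Bézout is
  -- used in this subtraction-free form since exponents are natural numbers.
  ∈-xpow-1-difference : ∀ x m y n {g} → g ℕ.+ y ℕ.* n ≡ x ℕ.* m →
    xpow-1 m ∈⟨ b , c ⟩ → xpow-1 n ∈⟨ b , c ⟩ → xpow-1 g ∈⟨ b , c ⟩
  ∈-xpow-1-difference x m y n {g} eq hm hn = ∈-cong e
    (∈-combine (geo m x) (negₚ (xpow g) *ₚ geo n y) hm hn)
    where
    open ≋-Reasoning
    regroup : ∀ a u b w v → a *ₚ u +ₚ (negₚ b *ₚ w) *ₚ v ≋ a *ₚ u -ₚ b *ₚ (w *ₚ v)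
    regroup = solve-∀ polyRing
    cancel : ∀ a b → (a *ₚ b -ₚ one) -ₚ a *ₚ (b -ₚ one) ≋ a -ₚ one
    cancel = solve-∀ polyRing
    e : geo m x *ₚ xpow-1 m +ₚ (negₚ (xpow g) *ₚ geo n y) *ₚ xpow-1 n ≋ xpow-1 g
    e = begin
      geo m x *ₚ xpow-1 m +ₚ (negₚ (xpow g) *ₚ geo n y) *ₚ xpow-1 n
        ≈⟨ regroup (geo m x) (xpow-1 m) (xpow g) (geo n y) (xpow-1 n) ⟩
      geo m x *ₚ xpow-1 m -ₚ xpow g *ₚ (geo n y *ₚ xpow-1 n)
        ≈⟨ +-cong (≋-sym (xpow-1-geo m x)) (-‿cong (*-cong (≋-refl {xpow g}) (≋-sym (xpow-1-geo n y)))) ⟩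
      xpow-1 (x ℕ.* m) -ₚ xpow g *ₚ xpow-1 (y ℕ.* n)
        ≡⟨ cong (λ i → xpow-1 i -ₚ xpow g *ₚ xpow-1 (y ℕ.* n)) (sym eq) ⟩
      xpow-1 (g ℕ.+ y ℕ.* n) -ₚ xpow g *ₚ xpow-1 (y ℕ.* n)
        ≈⟨ +-cong (+-cong (xpow-+ g (y ℕ.* n)) ≋-refl) (≋-refl {negₚ (xpow g *ₚ xpow-1 (y ℕ.* n))}) ⟩
      (xpow g *ₚ xpow (y ℕ.* n) -ₚ one) -ₚ xpow g *ₚ xpow-1 (y ℕ.* n)
        ≈⟨ cancel (xpow g) (xpow (y ℕ.* n)) ⟩
      xpow-1 g ∎

  ∈-xpow-1-gcd : ∀ m n → xpow-1 m ∈⟨ b , c ⟩ → xpow-1 n ∈⟨ b , c ⟩ → xpow-1 (gcd m n) ∈⟨ b , c ⟩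
  ∈-xpow-1-gcd m n hm hn with Bézout.identity (gcd-GCD m n)
  ... | Bézout.+- x y eq = ∈-xpow-1-difference x m y n eq hm hn
  ... | Bézout.-+ x y eq = ∈-xpow-1-difference y n x m eq hn hm

-- Coprimality over ℚ with denominators cleared. Over ℤ a unit cannot be asked for: the ideal of x -
-- 1 and x + 1 contains 2 but not 1.
Comaximal : Poly → Poly → Set
Comaximal b c = ∃[ K ] (K ≢ + 0 × [ K ] ∈⟨ b , c ⟩)

Comaximal-one : ∀ b → Comaximal b one
Comaximal-one b = + 1 , (λ ()) , ∈-right {b} {one} (one , ≋-sym (coeffwise (*-identityˡ one)))

-- Multiply the two combinations: every term except v v′ c c′ contains b.
Comaximal-* : ∀ {b c c′} → Comaximal b c → Comaximal b c′ → Comaximal b (c *ₚ c′)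
Comaximal-* {b} {c} {c′} (K , K≢0 , u , v , e) (K′ , K′≢0 , u′ , v′ , e′) =
  K ℤ.* K′ , (λ KK′≡0 → nonzero (ℤₚ.i*j≡0⇒i≡0∨j≡0 K KK′≡0)) ,
  u *ₚ (u′ *ₚ b +ₚ v′ *ₚ c′) +ₚ v *ₚ (c *ₚ u′) , v *ₚ v′ ,
  ≋-trans (≋-sym ([]-* K [ K′ ])) (≋-trans (*-cong e e′) (collect u v u′ v′ b c c′))
  where
  nonzero : ¬ (K ≡ + 0 ⊎ K′ ≡ + 0)
  nonzero (inj₁ z) = K≢0 z
  nonzero (inj₂ z) = K′≢0 z
  collect : ∀ u v u′ v′ b c c′ → (u *ₚ b +ₚ v *ₚ c) *ₚ (u′ *ₚ b +ₚ v′ *ₚ c′)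
    ≋ (u *ₚ (u′ *ₚ b +ₚ v′ *ₚ c′) +ₚ v *ₚ (c *ₚ u′)) *ₚ b +ₚ (v *ₚ v′) *ₚ (c *ₚ c′)
  collect = solve-∀ polyRing

Comaximal-∏ : ∀ {b g} n → (∀ k → k < n → Comaximal b (g k)) → Comaximal b (∏ g n)
Comaximal-∏ {b} zero    h = Comaximal-one b
Comaximal-∏ {b} {g} (suc n) h =
  Comaximal-* {b} {∏ g n} (Comaximal-∏ n λ k k<n → h k (ℕₚ.m<n⇒m<1+n k<n)) (h n (ℕₚ.n<1+n n))

-- Multiplying K = u b + v c by `a` shows that b divides K a, hence K r for the remainder r of `a`.
-- Being of degree below that of b, K r vanishes, and so does r because K is nonzero.
Comaximal-∣ : ∀ {d b c} a → Monic d b → Comaximal b c → b ∣ₚ a *ₚ c → b ∣ₚ a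
Comaximal-∣ {d} {b} {c} a mb (K , K≢0 , u , v , e) (s , ac≋sb) with divMonic-spec a mb
... | a≋qb+r , r-small = q , ≋-trans a≋qb+r (≋-trans (+-congˡ {q *ₚ b} r≋0) (+-identityʳ (q *ₚ b)))
  where
  open ≋-Reasoning
  q = quotₚ a b
  r = remₚ a b
  t = (u *ₚ a +ₚ v *ₚ s) -ₚ [ K ] *ₚ q
  isolate : ∀ k x r → k *ₚ r ≋ k *ₚ (x +ₚ r) -ₚ k *ₚ x
  isolate = solve-∀ polyRing
  expand : ∀ u v a b c x → (u *ₚ b +ₚ v *ₚ c) *ₚ a -ₚ x ≋ ((u *ₚ a) *ₚ b +ₚ v *ₚ (a *ₚ c)) -ₚ x
  expand = solve-∀ polyRing
  collect : ∀ u v a b s k q → ((u *ₚ a) *ₚ b +ₚ v *ₚ (s *ₚ b)) -ₚ k *ₚ (q *ₚ b)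
    ≋ ((u *ₚ a +ₚ v *ₚ s) -ₚ k *ₚ q) *ₚ b
  collect = solve-∀ polyRing
  Kr≋tb : [ K ] *ₚ r ≋ t *ₚ b
  Kr≋tb = begin
    [ K ] *ₚ r                                                         ≈⟨ isolate [ K ] (q *ₚ b) r ⟩
    [ K ] *ₚ (q *ₚ b +ₚ r) -ₚ [ K ] *ₚ (q *ₚ b)                        ≈⟨ +-congʳ {negₚ ([ K ] *ₚ (q *ₚ b))} (*-cong e (≋-sym a≋qb+r)) ⟩
    (u *ₚ b +ₚ v *ₚ c) *ₚ a -ₚ [ K ] *ₚ (q *ₚ b)                       ≈⟨ expand u v a b c _ ⟩
    ((u *ₚ a) *ₚ b +ₚ v *ₚ (a *ₚ c)) -ₚ [ K ] *ₚ (q *ₚ b)              ≈⟨ +-congʳ {negₚ ([ K ] *ₚ (q *ₚ b))} (+-congˡ {(u *ₚ a) *ₚ b} (*-cong (≋-refl {v}) ac≋sb)) ⟩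
    ((u *ₚ a) *ₚ b +ₚ v *ₚ (s *ₚ b)) -ₚ [ K ] *ₚ (q *ₚ b)              ≈⟨ collect u v a b s [ K ] q ⟩
    t *ₚ b                                                             ∎
  Kr : ∀ k → coeff ([ K ] *ₚ r) k ≡ K ℤ.* coeff r k
  Kr k = trans (at ([]-* K r) k) (coeff-scale K r k)
  t≋0 : t ≋ []
  t≋0 = small-multiple-zero t mb (Below-cong {a = [ K ] *ₚ r} Kr≋tb
    λ k d≤k → trans (Kr k) (trans (cong (K ℤ.*_) (r-small k d≤k)) (ℤₚ.*-zeroʳ K)))
  r≋0 : r ≋ []
  r≋0 = coeffwise λ k → nonzero (ℤₚ.i*j≡0⇒i≡0∨j≡0 K
    (trans (sym (Kr k)) (trans (at Kr≋tb k) (at (*-zeroˡ-≋ b t≋0) k))))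
    where
    nonzero : ∀ {x} → K ≡ + 0 ⊎ x ≡ + 0 → x ≡ + 0
    nonzero (inj₁ z) = ⊥-elim (K≢0 z)
    nonzero (inj₂ z) = z

-- Each of the `k` powers of x^g in the sum is 1 modulo x^g - 1. This is the source of the integer n
-- / gcd(c, n).
geo-const : ∀ g k → xpow-1 g ∣ₚ geo g k -ₚ [ + k ]
geo-const g zero    = [] , coeffwise λ { zero → refl ; (suc k) → refl }
geo-const g (suc k) with geo-const g k
... | q , e = geo g k +ₚ q , (begin
  (one +ₚ xpow g *ₚ geo g k) -ₚ (one +ₚ [ + k ])       ≈⟨ regroup (xpow g) (geo g k) [ + k ] ⟩
  geo g k *ₚ xpow-1 g +ₚ (geo g k -ₚ [ + k ])          ≈⟨ +-congˡ {geo g k *ₚ xpow-1 g} e ⟩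
  geo g k *ₚ xpow-1 g +ₚ q *ₚ xpow-1 g                 ≈⟨ collect (geo g k) q (xpow-1 g) ⟩
  (geo g k +ₚ q) *ₚ xpow-1 g                           ∎)
  where
  open ≋-Reasoning
  regroup : ∀ x y k → (one +ₚ x *ₚ y) -ₚ (one +ₚ k) ≋ y *ₚ (x -ₚ one) +ₚ (y -ₚ k)
  regroup = solve-∀ polyRing
  collect : ∀ x y z → x *ₚ z +ₚ y *ₚ z ≋ (x +ₚ y) *ₚ z
  collect = solve-∀ polyRing

∣ₚ-trans : ∀ {a b c} → a ∣ₚ b → b ∣ₚ c → a ∣ₚ c
∣ₚ-trans {a} (q , e) (q′ , e′) = q′ *ₚ q ,
  ≋-trans e′ (≋-trans (*-cong (≋-refl {q′}) e) (≋-sym (coeffwise (*-assoc q′ q a))))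

Φ∣xpow-1 : ∀ {n} → Cyclotomic n → Φ n ∣ₚ xpow-1 n
Φ∣xpow-1 {n} c = ∏ (Φ∣ n) n , ≋-trans (factors c) (coeffwise (*-comm (Φ n) _))

-- Among the proper divisors of N, those dividing g multiply to x^g - 1; cancelling it from x^N - 1
-- leaves Φ_N times the others, collected in `rest`.
Φ∣geo : ∀ {g} k → Cyclotomic g → Cyclotomic (k ℕ.* g) → 0 < g → g < k ℕ.* g → Φ (k ℕ.* g) ∣ₚ geo g k
Φ∣geo {g} k cg cN 0<g g<N = ∏ rest N , *-cancelʳ (geo g k) _ (xpow-1-Monic g 0<g) (begin
  geo g k *ₚ xpow-1 g                        ≈⟨ xpow-1-geo g k ⟨
  xpow-1 N                                   ≈⟨ factors cN ⟩
  Φ N *ₚ ∏ (Φ∣ N) N                          ≈⟨ *-cong (≋-refl {Φ N}) (∏-cong N λ d _ → split d) ⟩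
  Φ N *ₚ ∏ (λ d → Φ∣ g d *ₚ rest d) N        ≈⟨ *-cong (≋-refl {Φ N}) (∏-* (Φ∣ g) rest N) ⟩
  Φ N *ₚ (∏ (Φ∣ g) N *ₚ ∏ rest N)            ≈⟨ *-cong (≋-refl {Φ N}) (*-cong (≋-sym (∏Φ∣ cg 0<g g<N)) (≋-refl {∏ rest N})) ⟩
  Φ N *ₚ (xpow-1 g *ₚ ∏ rest N)              ≈⟨ regroup (Φ N) (xpow-1 g) (∏ rest N) ⟩
  (∏ rest N *ₚ Φ N) *ₚ xpow-1 g              ∎)
  where
  open ≋-Reasoning
  N = k ℕ.* g
  rest : ℕ → Poly
  rest d = ⟦ d ∣? N ⟧ ⟦ ¬? (d ∣? g) ⟧ Φ d
  regroup : ∀ a b c → a *ₚ (b *ₚ c) ≋ (c *ₚ a) *ₚ b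
  regroup = solve-∀ polyRing
  split : ∀ d → Φ∣ N d ≋ Φ∣ g d *ₚ rest d
  split d with d ∣? g
  ... | yes d∣g = ≋-trans (⟦⟧-true (d ∣? N) (∣.∣n⇒∣m*n k d∣g)) (≋-sym (*-oneʳ (Φ d) (⟦⟧-one (d ∣? N))))
  ... | no _ = ≋-sym (*-oneˡ _ ≋-refl)

module _ {c N} (cyc : ∀ d → 0 < d → d ≤ N → Cyclotomic d) (0<c : 0 < c) (c<N : c < N) where

  private
    g = gcd c N
    g≤c : g ≤ c
    g≤c = ∣.∣⇒≤ {{ℕ.>-nonZero 0<c}} (gcd[m,n]∣m c N)
    0<g : 0 < g
    0<g = ℕₚ.n≢0⇒n>0 λ g≡0 → ℕₚ.<⇒≢ 0<c (sym (gcd[m,n]≡0⇒m≡0 g≡0))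

  -- Modulo the ideal (Φ_N, Φ_c) one has x^g = 1, so 0 = (x^N − 1)/(x^g − 1) = N/g.
  Φ-Comaximal : Comaximal (Φ N) (Φ c)
  Φ-Comaximal = from (gcd[m,n]∣n c N)
    where
    cycc = cyc c 0<c (ℕₚ.<⇒≤ c<N)
    cycN = cyc N (ℕₚ.<-trans 0<c c<N) ℕₚ.≤-refl
    xᵍ-1∈ : xpow-1 g ∈⟨ Φ N , Φ c ⟩
    xᵍ-1∈ = ∈-xpow-1-gcd c N (∈-right {Φ N} (Φ∣xpow-1 cycc)) (∈-left {Φ N} (Φ∣xpow-1 cycN))
    from : g ∣ N → Comaximal (Φ N) (Φ c)
    from (divides k N≡kg) = + k , k≢0 , ∈-cong (difference (geo g k) [ + k ])
      (∈-combine one (negₚ one) (∈-left {Φ N} Φ∣G) (∈-cong (≋-sym (proj₂ G-k)) G-k∈))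
      where
      k≢0 : + k ≢ + 0
      k≢0 e = ℕₚ.n≮0 (subst (c <_) (trans N≡kg (cong (ℕ._* g) (ℤₚ.+-injective e))) c<N)
      G-k = geo-const g k
      Φ∣G : Φ N ∣ₚ geo g k
      Φ∣G = subst (λ n → Φ n ∣ₚ geo g k) (sym N≡kg) (Φ∣geo k
        (cyc g 0<g (ℕₚ.≤-trans g≤c (ℕₚ.<⇒≤ c<N))) (subst Cyclotomic N≡kg cycN) 0<g
        (subst (g <_) N≡kg (ℕₚ.≤-<-trans g≤c c<N)))
      pad : ∀ q a → q *ₚ a +ₚ [] *ₚ a ≋ q *ₚ a
      pad = solve-∀ polyRing
      G-k∈ : proj₁ G-k *ₚ xpow-1 g ∈⟨ Φ N , Φ c ⟩
      G-k∈ = ∈-cong (pad (proj₁ G-k) (xpow-1 g)) (∈-combine (proj₁ G-k) [] xᵍ-1∈ xᵍ-1∈)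
      difference : ∀ a b → one *ₚ a +ₚ negₚ one *ₚ (a -ₚ b) ≋ b
      difference = solve-∀ polyRing

∣-positive : ∀ {d n} → 0 < n → d ∣ n → 0 < d
∣-positive {zero}  0<n 0∣n = ⊥-elim (ℕₚ.<⇒≢ 0<n (sym (∣.0∣⇒≡0 0∣n)))
∣-positive {suc d} _   _   = s≤s z≤n

-- Divisors are split off one at a time. If N ∣ n, then Φ_N divides x^N - 1 and so x^n - 1 = R L; it
-- is coprime up to an integer to each factor of L, hence it divides the cofactor R.
∏Φ∣-divides : ∀ {n} → (∀ d → 0 < d → d < n → Cyclotomic d) → 0 < n →
  ∀ N → N ≤ n → ∏ (Φ∣ n) N ∣ₚ xpow-1 n
∏Φ∣-divides {n} cyc 0<n zero    _   = xpow-1 n , ≋-sym (*-oneʳ (xpow-1 n) ≋-refl)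
∏Φ∣-divides {n} cyc 0<n (suc N) N<n with ∏Φ∣-divides cyc 0<n N (ℕₚ.<⇒≤ N<n)
... | R , e with N ∣? n
...   | no _    = R , ≋-trans e (*-cong (≋-refl {R}) (≋-sym (*-oneʳ _ ≋-refl)))
...   | yes N∣n = s , ≋-trans e (≋-trans (*-cong R≋sΦ (≋-refl {L})) (regroup s (Φ N) L))
  where
  L = ∏ (Φ∣ n) N
  cycN = cyc N (∣-positive 0<n N∣n) N<n
  comaximal : ∀ c → c < N → Comaximal (Φ N) (Φ∣ n c)
  comaximal c c<N with c ∣? n
  ... | no _    = Comaximal-one (Φ N)
  ... | yes c∣n = Φ-Comaximal (λ d 0<d d≤N → cyc d 0<d (ℕₚ.≤-<-trans d≤N N<n)) (∣-positive 0<n c∣n) c<N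
  Φ∣R : Φ N ∣ₚ R
  Φ∣R = Comaximal-∣ R (Φ-Monic cycN) (Comaximal-∏ {g = Φ∣ n} N comaximal)
    (∣-cong e (∣ₚ-trans (Φ∣xpow-1 cycN) (xpow-1-∣ N∣n)))
    where
    ∣-cong : ∀ {a b c} → a ≋ b → c ∣ₚ a → c ∣ₚ b
    ∣-cong e (q , f) = q , ≋-trans (≋-sym e) f
  s = proj₁ Φ∣R
  R≋sΦ = proj₂ Φ∣R
  regroup : ∀ a b c → (a *ₚ b) *ₚ c ≋ a *ₚ (c *ₚ b)
  regroup = solve-∀ polyRing

cyclotomic : ∀ n → 0 < n → Cyclotomic n
cyclotomic = <-rec _ λ n rec → step n λ d 0<d d<n → rec d<n 0<d
  where
  step : ∀ n → (∀ d → 0 < d → d < n → Cyclotomic d) → 0 < n → Cyclotomic n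
  step (suc n) cyc 0<n = record { Φ-Monic = proj₂ (proj₂ Φ-factor) ; factors = factors′ }
    where
    B = prodₚ (map (Φ ∘ suc) (filter (λ d → suc d ∣? suc n) (upTo n)))
    Φ∣-Monic : ∀ d → d < suc n → ∃[ e ] Monic e (Φ∣ (suc n) d)
    Φ∣-Monic zero    _   = ⟦⟧-Monic (0 ∣? suc n) λ _ → 0 , Monic-one
    Φ∣-Monic (suc d) d<n = ⟦⟧-Monic (suc d ∣? suc n) λ _ → _ , Φ-Monic (cyc (suc d) (s≤s z≤n) d<n)
    ∏-monic = ∏-Monic {Φ∣ (suc n)} (suc n) Φ∣-Monic
    B-Monic : Monic (proj₁ ∏-monic) B
    B-Monic = Monic-cong (≋-sym (∏Φ∣-proper n)) (proj₂ ∏-monic)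
    B∣ : B ∣ₚ xpow-1 (suc n)
    B∣ with ∏Φ∣-divides cyc 0<n (suc n) ℕₚ.≤-refl
    ... | q , e = q , ≋-trans e (*-cong (≋-refl {q}) (≋-sym (∏Φ∣-proper n)))
    exact : xpow-1 (suc n) ≋ Φ (suc n) *ₚ B
    exact rewrite Φ-unfold n = quotₚ-exact (xpow-1 (suc n)) B-Monic B∣
    factors′ = ≋-trans exact (*-cong (≋-refl {Φ (suc n)}) (∏Φ∣-proper n))
    Φ-factor = Monic-factor (Φ (suc n)) B (Monic-cong exact (xpow-1-Monic (suc n) 0<n)) B-Monic

-- Substituting a power of x

module _ (e : ℕ) where

  private
    σ : Poly → Poly
    σ = substPow e
    X = xpow e

  [0]≋[] : [ + 0 ] ≋ []
  [0]≋[] = coeffwise λ { zero → refl ; (suc k) → refl }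

  substPow-zero : ∀ a → a ≋ [] → σ a ≋ []
  substPow-zero []      _ = ≋-refl
  substPow-zero (x ∷ a) h with refl ← at h 0 = ≋-trans
    (+-cong [0]≋[] (*-cong (≋-refl {X}) (substPow-zero a (coeffwise λ k → at h (suc k)))))
    (coeffwise (*-zeroʳ X))

  -- `substPow` recurses on the list, so two lists for the same polynomial must be compared
  -- explicitly; the surplus tail is handled by `substPow-zero`.
  substPow-cong : ∀ a b → a ≋ b → σ a ≋ σ b
  substPow-cong []      b       h = ≋-sym (substPow-zero b (≋-sym h))
  substPow-cong (x ∷ a) []      h = substPow-zero (x ∷ a) h
  substPow-cong (x ∷ a) (y ∷ b) h with refl ← at h 0 = +-congˡ {[ x ]}
    (*-cong (≋-refl {X}) (substPow-cong a b (coeffwise λ k → at h (suc k))))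

  substPow-+ : ∀ a b → σ (a +ₚ b) ≋ σ a +ₚ σ b
  substPow-+ []      b       = ≋-refl
  substPow-+ (x ∷ a) []      = ≋-sym (+-identityʳ (σ (x ∷ a)))
  substPow-+ (x ∷ a) (y ∷ b) = ≋-trans
    (+-congˡ {[ x ] +ₚ [ y ]} (*-cong (≋-refl {X}) (substPow-+ a b)))
    (regroup [ x ] [ y ] X (σ a) (σ b))
    where
    regroup : ∀ x y z a b → (x +ₚ y) +ₚ z *ₚ (a +ₚ b) ≋ (x +ₚ z *ₚ a) +ₚ (y +ₚ z *ₚ b)
    regroup = solve-∀ polyRing

  substPow-neg : ∀ a → σ (negₚ a) ≋ negₚ (σ a)
  substPow-neg []      = ≋-refl
  substPow-neg (x ∷ a) = ≋-trans
    (+-congˡ {negₚ [ x ]} (*-cong (≋-refl {X}) (substPow-neg a))) (regroup [ x ] X (σ a))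
    where
    regroup : ∀ x z a → negₚ x +ₚ z *ₚ negₚ a ≋ negₚ (x +ₚ z *ₚ a)
    regroup = solve-∀ polyRing

  substPow-scale : ∀ c a → σ (scaleₚ c a) ≋ [ c ] *ₚ σ a
  substPow-scale c []      = ≋-sym (coeffwise (*-zeroʳ [ c ]))
  substPow-scale c (x ∷ a) = ≋-trans
    (+-cong (≋-sym ([]-* c [ x ])) (*-cong (≋-refl {X}) (substPow-scale c a)))
    (regroup [ c ] [ x ] X (σ a))
    where
    regroup : ∀ c x z a → c *ₚ x +ₚ z *ₚ (c *ₚ a) ≋ c *ₚ (x +ₚ z *ₚ a)
    regroup = solve-∀ polyRing

  substPow-* : ∀ a b → σ (a *ₚ b) ≋ σ a *ₚ σ b
  substPow-* []      b = ≋-refl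
  substPow-* (x ∷ a) b = begin
    σ (scaleₚ x b +ₚ (+ 0 ∷ a *ₚ b))             ≈⟨ substPow-+ (scaleₚ x b) (+ 0 ∷ a *ₚ b) ⟩
    σ (scaleₚ x b) +ₚ ([ + 0 ] +ₚ X *ₚ σ (a *ₚ b)) ≈⟨ +-cong (substPow-scale x b) (+-cong [0]≋[] (*-cong (≋-refl {X}) (substPow-* a b))) ⟩
    [ x ] *ₚ σ b +ₚ X *ₚ (σ a *ₚ σ b)            ≈⟨ regroup [ x ] X (σ a) (σ b) ⟩
    ([ x ] +ₚ X *ₚ σ a) *ₚ σ b                   ∎
    where
    open ≋-Reasoning
    regroup : ∀ x z a b → x *ₚ b +ₚ z *ₚ (a *ₚ b) ≋ (x +ₚ z *ₚ a) *ₚ b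
    regroup = solve-∀ polyRing

  substPow-[] : ∀ c → σ [ c ] ≋ [ c ]
  substPow-[] c = ≋-trans (+-congˡ {[ c ]} {X *ₚ []} {[]} (coeffwise (*-zeroʳ X))) (+-identityʳ [ c ])

  substPow-xpow : ∀ n → σ (xpow n) ≋ xpow (n ℕ.* e)
  substPow-xpow zero    = substPow-[] (+ 1)
  substPow-xpow (suc n) = ≋-trans (+-cong [0]≋[] (*-cong (≋-refl {X}) (substPow-xpow n)))
    (≋-sym (xpow-+ e (n ℕ.* e)))

  substPow-xpow-1 : ∀ n → σ (xpow-1 n) ≋ xpow-1 (n ℕ.* e)
  substPow-xpow-1 n = ≋-trans (substPow-+ (xpow n) (negₚ one)) (+-cong (substPow-xpow n)
    (≋-trans (substPow-neg one) (-‿cong (substPow-[] (+ 1)))))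

  substPow-∏ : ∀ g n → σ (∏ g n) ≋ ∏ (σ ∘ g) n
  substPow-∏ g zero    = substPow-[] (+ 1)
  substPow-∏ g (suc n) = ≋-trans (substPow-* (∏ g n) (g n)) (*-cong (substPow-∏ g n) (≋-refl {σ (g n)}))

  substPow-⟦⟧ : ∀ {P : Set} (P? : Dec P) a → σ (⟦ P? ⟧ a) ≋ ⟦ P? ⟧ σ a
  substPow-⟦⟧ (yes _) a = ≋-refl
  substPow-⟦⟧ (no _)  a = substPow-[] (+ 1)

  -- For positive `e` the constant term stays below the shifted leading term; for e = 0 all
  -- coefficients would collapse into one.
  substPow-Monic : 0 < e → ∀ {d} a → Monic d a → Monic (d ℕ.* e) (σ a)
  substPow-Monic 0<e         []      (monic _ ())
  substPow-Monic 0<e {zero}  (x ∷ a) (monic h refl) = Monic-cong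
    (≋-sym (substPow-cong (x ∷ a) one (coeffwise λ { zero → refl ; (suc k) → h (suc k) (s≤s z≤n) })))
    (Monic-cong (≋-sym (substPow-[] (+ 1))) Monic-one)
  substPow-Monic 0<e {suc d} (x ∷ a) (monic h l) = monic
    (Below-+ [ x ] (X *ₚ σ a) (λ k le → low (ℕₚ.≤-trans (s≤s z≤n) le)) (degree shifted))
    (trans (coeff-+ [ x ] (X *ₚ σ a) (e ℕ.+ d ℕ.* e)) (cong₂ ℤ._+_ (low (ℕₚ.m≤n⇒m≤n+o (d ℕ.* e) 0<e)) (leading shifted)))
    where
    shifted : Monic (e ℕ.+ d ℕ.* e) (X *ₚ σ a)
    shifted = Monic-* X (σ a) (xpow-Monic e)
      (substPow-Monic 0<e a (monic (λ k le → h (suc k) (s≤s le)) l))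
    low : ∀ {k} → 0 < k → coeff [ x ] k ≡ + 0
    low {suc k} _ = refl

-- Φ_n(x^p) for a prime p, and the positive degree of Φ_n

∣*prime : ∀ {p d n} → Prime p → ¬ p ∣ d → d ∣ n ℕ.* p → d ∣ n
∣*prime {p} {d} {n} pr p∤d d∣np = coprime-divisor coprime (subst (d ∣_) (ℕₚ.*-comm n p) d∣np)
  where
  coprime : Coprime d p
  coprime {i} (i∣d , i∣p) with prime⇒irreducible pr i∣p
  ... | inj₁ i≡1  = i≡1
  ... | inj₂ refl = ⊥-elim (p∤d i∣d)

∤-between : ∀ {p} e {r} → 0 < r → r < p → ¬ p ∣ e ℕ.* p ℕ.+ r
∤-between {p} e {suc r} _ r<p p∣ep+r = ℕₚ.<⇒≱ r<p (∣.∣⇒≤ (∣.∣m+n∣m⇒∣n p∣ep+r (∣.n∣m*n e)))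

module _ {p : ℕ} (pr : Prime p) where

  private
    0<p : 0 < p
    0<p = ℕ.>-nonZero⁻¹ p {{prime⇒nonZero pr}}

    -- The factor that Φ_d(x^p) has besides Φ_dp: it is Φ_d if p ∤ d, and trivial otherwise.
    coprimePart : ℕ → Poly
    coprimePart d = ⟦ ¬? (p ∣? d) ⟧ Φ d

  -- The divisors of n p are the d p with d ∣ n, together with the divisors of n prime to p.
  divisors-*-prime : ∀ n → 0 < n →
    xpow-1 (n ℕ.* p) ≋ ∏ (λ d → ⟦ d ∣? n ⟧ (Φ (d ℕ.* p) *ₚ coprimePart d)) (suc n)
  divisors-*-prime n 0<n = begin
    xpow-1 np
      -- The range is extended to `suc n * p`, beyond np, so that it consists of whole blocks of
      -- length p.
      ≈⟨ ∏Φ∣ (cyclotomic np 0<np) 0<np (ℕₚ.m<n+m np 0<p) ⟩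
    ∏ (Φ∣ np) (suc n ℕ.* p)
      ≈⟨ ∏-cong (suc n ℕ.* p) (λ d _ → split d) ⟩
    ∏ (λ d → multiple d *ₚ ⟦ d ∣? n ⟧ coprimePart d) (suc n ℕ.* p)
      ≈⟨ ∏-* multiple (λ d → ⟦ d ∣? n ⟧ coprimePart d) (suc n ℕ.* p) ⟩
    ∏ multiple (suc n ℕ.* p) *ₚ ∏ (λ d → ⟦ d ∣? n ⟧ coprimePart d) (suc n ℕ.* p)
      ≈⟨ *-cong (∏-multiples p (suc n) (λ e r 0<r r<p → ⟦⟧-false (p ∣? _) (∤-between e 0<r r<p)) 0<p)
           (∏-extend (ℕₚ.m≤m*n (suc n) p {{prime⇒nonZero pr}}) λ d n<d → ⟦⟧-false (d ∣? n) λ d∣n →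
             ℕₚ.<⇒≱ n<d (∣.∣⇒≤ {{ℕ.>-nonZero 0<n}} d∣n)) ⟩
    ∏ (λ e → multiple (e ℕ.* p)) (suc n) *ₚ ∏ (λ d → ⟦ d ∣? n ⟧ coprimePart d) (suc n)
      ≈⟨ ∏-* (λ e → multiple (e ℕ.* p)) (λ d → ⟦ d ∣? n ⟧ coprimePart d) (suc n) ⟨
    ∏ (λ d → multiple (d ℕ.* p) *ₚ ⟦ d ∣? n ⟧ coprimePart d) (suc n)
      ≈⟨ ∏-cong (suc n) (λ d _ → merge d) ⟩
    ∏ (λ d → ⟦ d ∣? n ⟧ (Φ (d ℕ.* p) *ₚ coprimePart d)) (suc n) ∎
    where
    open ≋-Reasoning
    np = n ℕ.* p
    0<np : 0 < np
    0<np = ℕₚ.*-mono-≤ 0<n 0<p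
    multiple : ℕ → Poly
    multiple d = ⟦ p ∣? d ⟧ Φ∣ np d
    split : ∀ d → Φ∣ np d ≋ multiple d *ₚ ⟦ d ∣? n ⟧ coprimePart d
    split d with p ∣? d
    ... | yes p∣d = ≋-sym (*-oneʳ (Φ∣ np d) (⟦⟧-one (d ∣? n)))
    ... | no p∤d = ≋-trans (by-cases (d ∣? n)) (≋-sym (*-oneˡ _ ≋-refl))
      where
      by-cases : (d∣?n : Dec (d ∣ n)) → Φ∣ np d ≋ ⟦ d∣?n ⟧ Φ d
      by-cases (yes d∣n) = ⟦⟧-true (d ∣? np) (∣.∣m⇒∣m*n p d∣n)
      by-cases (no d∤n)  = ⟦⟧-false (d ∣? np) λ d∣np → d∤n (∣*prime pr p∤d d∣np)
    merge : ∀ d → multiple (d ℕ.* p) *ₚ ⟦ d ∣? n ⟧ coprimePart d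
      ≋ ⟦ d ∣? n ⟧ (Φ (d ℕ.* p) *ₚ coprimePart d)
    merge d = ≋-trans (*-cong (≋-trans (⟦⟧-true (p ∣? (d ℕ.* p)) (∣.n∣m*n d)) (by-cases (d ∣? n)))
        (≋-refl {⟦ d ∣? n ⟧ coprimePart d}))
      (≋-sym (⟦⟧-* (d ∣? n) (Φ (d ℕ.* p)) (coprimePart d)))
      where
      by-cases : (d∣?n : Dec (d ∣ n)) → Φ∣ np (d ℕ.* p) ≋ ⟦ d∣?n ⟧ Φ (d ℕ.* p)
      by-cases (yes d∣n) = ⟦⟧-true ((d ℕ.* p) ∣? np) (∣.*-monoˡ-∣ p d∣n)
      by-cases (no d∤n)  = ⟦⟧-false ((d ℕ.* p) ∣? np) λ dp∣np →
        d∤n (∣.*-cancelʳ-∣ p {{prime⇒nonZero pr}} dp∣np)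

  -- Both sides, multiplied over all d ∣ n, give x^{np} - 1: the left by substitution in x^n - 1,
  -- the right by `divisors-*-prime`. By induction the factors with d < n agree, and their monic
  -- product cancels.
  Φ-substPow : ∀ n → 0 < n → substPow p (Φ n) ≋ Φ (n ℕ.* p) *ₚ ⟦ ¬? (p ∣? n) ⟧ Φ n
  Φ-substPow = <-rec _ λ n rec → step n λ d 0<d d<n → rec d<n 0<d
    where
    step : ∀ n → (∀ d → 0 < d → d < n → substPow p (Φ d) ≋ Φ (d ℕ.* p) *ₚ coprimePart d) →
      0 < n → substPow p (Φ n) ≋ Φ (n ℕ.* p) *ₚ coprimePart n
    step n ih 0<n = begin
      substPow p (Φ n)   ≈⟨ ⟦⟧-true (n ∣? n) ∣.∣-refl ⟨
      left n             ≈⟨ *-cancelʳ (left n) (right n) (proj₂ left-Monic)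
                              (≋-trans (coeffwise (*-comm (left n) _)) (≋-trans both (coeffwise (*-comm (∏ left n) _)))) ⟩
      right n            ≈⟨ ⟦⟧-true (n ∣? n) ∣.∣-refl ⟩
      Φ (n ℕ.* p) *ₚ coprimePart n ∎
      where
      open ≋-Reasoning
      left right : ℕ → Poly
      left d  = ⟦ d ∣? n ⟧ substPow p (Φ d)
      right d = ⟦ d ∣? n ⟧ (Φ (d ℕ.* p) *ₚ coprimePart d)
      left-Monic : ∃[ d ] Monic d (∏ left n)
      left-Monic = ∏-Monic {left} n λ d d<n → ⟦⟧-Monic (d ∣? n) λ d∣n →
        _ , substPow-Monic p 0<p (Φ d) (Φ-Monic (cyclotomic d (∣-positive 0<n d∣n)))
      both : ∏ left n *ₚ left n ≋ ∏ left n *ₚ right n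
      both = begin
        ∏ left (suc n)                         ≈⟨ ∏-cong (suc n) (λ d _ → substPow-⟦⟧ p (d ∣? n) (Φ d)) ⟨
        ∏ (substPow p ∘ Φ∣ n) (suc n)          ≈⟨ substPow-∏ p (Φ∣ n) (suc n) ⟨
        substPow p (∏ (Φ∣ n) (suc n))          ≈⟨ substPow-cong p _ _ (∏Φ∣ (cyclotomic n 0<n) 0<n (ℕₚ.n<1+n n)) ⟨
        substPow p (xpow-1 n)                  ≈⟨ substPow-xpow-1 p n ⟩
        xpow-1 (n ℕ.* p)                       ≈⟨ divisors-*-prime n 0<n ⟩
        ∏ right n *ₚ right n                   ≈⟨ *-cong (∏-cong n λ d d<n → ⟦⟧-cong (d ∣? n) λ d∣n → ih d (∣-positive 0<n d∣n) d<n) (≋-refl {right n}) ⟨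
        ∏ left n *ₚ right n                    ∎

  -- Comparing degrees in `Φ-substPow` gives p φ(n) = φ(np) + ε with ε = 0 or ε = φ(n). If φ(np)
  -- were 0, then p φ(n) ≤ φ(n), impossible for p > 1.
  φ-*-prime : ∀ n (0<n : 0 < n) (0<np : 0 < n ℕ.* p) →
    0 < φ (cyclotomic n 0<n) → 0 < φ (cyclotomic (n ℕ.* p) 0<np)
  φ-*-prime n 0<n 0<np 0<φn = positive (p ∣? n) (Φ-substPow n 0<n)
    where
    cycn  = cyclotomic n 0<n
    cycnp = cyclotomic (n ℕ.* p) 0<np
    σΦ : Monic (φ cycn ℕ.* p) (substPow p (Φ n))
    σΦ = substPow-Monic p 0<p (Φ n) (Φ-Monic cycn)
    1<p : 1 < p
    1<p = ℕ.nonTrivial⇒n>1 p {{prime⇒nonTrivial pr}}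
    bound : ∀ ε → ε ≤ φ cycn → φ cycn ℕ.* p ≡ φ cycnp ℕ.+ ε → 0 < φ cycnp
    bound ε ε≤φ eq with φ cycnp
    ... | suc _ = s≤s z≤n
    ... | zero  = ⊥-elim (ℕₚ.<⇒≱ (ℕₚ.m<m*n (φ cycn) p {{ℕ.>-nonZero 0<φn}} 1<p)
                    (ℕₚ.≤-trans (ℕₚ.≤-reflexive eq) ε≤φ))
    positive : (p∣?n : Dec (p ∣ n)) → substPow p (Φ n) ≋ Φ (n ℕ.* p) *ₚ ⟦ ¬? p∣?n ⟧ Φ n → 0 < φ cycnp
    positive (yes _) e = bound 0 z≤n (Monic-unique σΦ
      (Monic-cong (≋-sym e) (Monic-* _ _ (Φ-Monic cycnp) Monic-one)))
    positive (no _)  e = bound (φ cycn) ℕₚ.≤-refl (Monic-unique σΦ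
      (Monic-cong (≋-sym e) (Monic-* _ _ (Φ-Monic cycnp) (Φ-Monic cycn))))

-- Φ_1 has degree 1, and restoring one prime factor at a time keeps the degree positive.
φ-positive : ∀ n (0<n : 0 < n) → 0 < φ (cyclotomic n 0<n)
φ-positive = <-rec _ λ n rec 0<n → step n 0<n (λ d d<n 0<d → rec d<n 0<d) 
  where
  step : ∀ n (0<n : 0 < n) → (∀ d → d < n → (0<d : 0 < d) → 0 < φ (cyclotomic d 0<d)) →
    0 < φ (cyclotomic n 0<n)
  step n 0<n ih with factorise n {{ℕ.>-nonZero 0<n}}
  ... | record { factors = [] ; isFactorisation = refl } =
    ℕₚ.≤-reflexive (trans (Monic-unique (xpow-1-Monic 1 0<n) (Monic-cong (≋-sym (factors (cyclotomic 1 0<n)))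
      (Monic-* (Φ 1) one (Φ-Monic (cyclotomic 1 0<n)) Monic-one))) (ℕₚ.+-identityʳ _))
  ... | record { factors = p ∷ ps ; isFactorisation = eq ; factorsPrime = pr ∷ _ } =
    go (product ps) (trans eq (ℕₚ.*-comm p (product ps)))
    where
    go : ∀ n′ → n ≡ n′ ℕ.* p → 0 < φ (cyclotomic n 0<n)
    go zero     refl = ⊥-elim (ℕₚ.n≮0 0<n)
    go (suc n′) refl = φ-*-prime pr (suc n′) (s≤s z≤n) 0<n
      (ih (suc n′) (ℕₚ.m<m*n (suc n′) p (ℕ.nonTrivial⇒n>1 p {{prime⇒nonTrivial pr}})) (s≤s z≤n))

-- Cutting the coefficient sequence

take-drop : ∀ n a → a ≋ take n a +ₚ xpow n *ₚ drop n a
take-drop zero    a       = ≋-sym (coeffwise (*-identityˡ a))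
take-drop (suc n) []      = ≋-sym (coeffwise (*-zeroʳ (xpow (suc n))))
take-drop (suc n) (x ∷ a) = ≋-sym (≋-trans (+-congˡ {x ∷ take n a} (xpow-suc-* n (drop n a)))
  (coeffwise λ { zero → ℤₚ.+-identityʳ x ; (suc k) → sym (at (take-drop n a) k) }))

Below-take : ∀ n a → Below n (take n a)
Below-take zero    a       k       _       = refl
Below-take (suc n) []      k       _       = refl
Below-take (suc n) (x ∷ a) (suc k) (s≤s l) = Below-take n a k l

coeff-take : ∀ n a {k} → k < n → coeff (take n a) k ≡ coeff a k
coeff-take (suc n) []      _               = refl
coeff-take (suc n) (x ∷ a) {zero}  _       = refl
coeff-take (suc n) (x ∷ a) {suc k} (s≤s l) = coeff-take n a l

coeff-drop : ∀ n a k → coeff (drop n a) k ≡ coeff a (n ℕ.+ k)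
coeff-drop zero    a       k = refl
coeff-drop (suc n) []      k = refl
coeff-drop (suc n) (x ∷ a) k = coeff-drop n a k

drop-suc : ∀ n a → drop n a ≋ coeff a n ∷ drop (suc n) a
drop-suc n a = coeffwise λ
  { zero    → trans (coeff-drop n a 0) (cong (coeff a) (ℕₚ.+-identityʳ n))
  ; (suc k) → trans (coeff-drop n a (suc k))
      (trans (cong (coeff a) (ℕₚ.+-suc n k)) (sym (coeff-drop (suc n) a k))) }

coeff-tabulated : ∀ (h : ℕ → ℤ) g n {k} → k < n → coeff (map h (applyUpTo g n)) k ≡ h (g k)
coeff-tabulated h g (suc n) {zero}  _       = refl
coeff-tabulated h g (suc n) {suc k} (s≤s l) = coeff-tabulated h (g ∘ suc) n l

Below-tabulated : ∀ (h : ℕ → ℤ) g n → Below n (map h (applyUpTo g n))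
Below-tabulated h g zero    k       _       = refl
Below-tabulated h g (suc n) (suc k) (s≤s l) = Below-tabulated h (g ∘ suc) n k l

Below-agree : ∀ n a b → Below n a → Below n b → (∀ k → k < n → coeff a k ≡ coeff b k) → a ≋ b
Below-agree n a b ha hb e = coeffwise agree
  where
  agree : ∀ k → coeff a k ≡ coeff b k
  agree k with k ℕₚ.<? n
  ... | yes k<n = e k k<n
  ... | no k≮n  = trans (ha k (ℕₚ.≮⇒≥ k≮n)) (sym (hb k (ℕₚ.≮⇒≥ k≮n)))

-- As m ≤ p, the inner slice ends before the outer one does, so the two merge into a single window
-- of Φ_mp.
fij-zero : ∀ m p i → m ≤ p → fij m p i 0 ≋ take m (drop (i ℕ.* p) (Φ (m ℕ.* p)))
fij-zero m p i m≤p = Below-agree m (fij m p i 0) _ (Below-tabulated _ id m)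
  (Below-take m (drop (i ℕ.* p) F)) λ k k<m → trans (coeff-tabulated _ id m k<m)
    (trans (coeff-tabulated _ id p (ℕₚ.<-≤-trans k<m m≤p))
    (sym (trans (coeff-take m (drop (i ℕ.* p) F) k<m) (coeff-drop (i ℕ.* p) F k))))
  where F = Φ (m ℕ.* p)

-- For `c = coeff (Φ m)` these are the terms of Φ_m(x^p) of degree at most ip.
lowPart : ℕ → (ℕ → ℤ) → ℕ → Poly
lowPart p c zero    = [ c 0 ]
lowPart p c (suc i) = lowPart p c i +ₚ xpow (suc i ℕ.* p) *ₚ [ c (suc i) ]

Below-lowPart : ∀ p c i → Below (suc (i ℕ.* p)) (lowPart p c i)
Below-lowPart p c zero    (suc k) _ = refl
Below-lowPart p c (suc i) = Below-+ (lowPart p c i) _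
  (Below-mono {a = lowPart p c i} (s≤s (ℕₚ.m≤n+m (i ℕ.* p) p)) (Below-lowPart p c i))
  (subst (λ n → Below n (xpow N *ₚ [ c (suc i) ])) (ℕₚ.+-identityʳ (suc N))
    (Below-* {suc N} (xpow N) [ c (suc i) ] (degree (xpow-Monic N)) λ { (suc k) _ → refl }))
  where N = suc i ℕ.* p

substPow-lowPart : ∀ p a i →
  substPow p a ≋ lowPart p (coeff a) i +ₚ xpow (suc i ℕ.* p) *ₚ substPow p (drop (suc i) a)
substPow-lowPart p a zero = ≋-trans (substPow-cong p a _ (drop-suc 0 a))
  (+-congˡ {[ coeff a 0 ]} (*-cong (+-pad p) (≋-refl {substPow p (drop 1 a)})))
  where
  +-pad : ∀ p → xpow p ≋ xpow (p ℕ.+ 0)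
  +-pad p rewrite ℕₚ.+-identityʳ p = ≋-refl
substPow-lowPart p a (suc i) = begin
  substPow p a
    ≈⟨ substPow-lowPart p a i ⟩
  L +ₚ xpow N *ₚ substPow p (drop (suc i) a)
    ≈⟨ +-congˡ {L} (*-cong (≋-refl {xpow N}) (substPow-cong p _ _ (drop-suc (suc i) a))) ⟩
  L +ₚ xpow N *ₚ (c +ₚ xpow p *ₚ rest)
    ≈⟨ regroup L (xpow N) c (xpow p) rest ⟩
  (L +ₚ xpow N *ₚ c) +ₚ (xpow p *ₚ xpow N) *ₚ rest
    ≈⟨ +-congˡ {L +ₚ xpow N *ₚ c} (*-cong (≋-sym (xpow-+ p N)) (≋-refl {rest})) ⟩
  (L +ₚ xpow N *ₚ c) +ₚ xpow (p ℕ.+ N) *ₚ rest ∎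
  where
  open ≋-Reasoning
  N    = suc i ℕ.* p
  L    = lowPart p (coeff a) i
  c    = [ coeff a (suc i) ]
  rest = substPow p (drop (suc (suc i)) a)
  regroup : ∀ l n c p r → l +ₚ n *ₚ (c +ₚ p *ₚ r) ≋ (l +ₚ n *ₚ c) +ₚ (p *ₚ n) *ₚ r
  regroup = solve-∀ polyRing

-- `w m i` is by definition `negₚ (reversed (coeff (Φ m)) i)`.
reversed : (ℕ → ℤ) → ℕ → Poly
reversed c i = map (λ t → c (i ℕ.∸ t)) (upTo (suc i))

reversed-suc : ∀ c i → reversed c (suc i) ≡ c (suc i) ∷ reversed c i
reversed-suc c i = cong (c (suc i) ∷_) (trans (Listₚ.map-applyUpTo suc (λ t → c (suc i ℕ.∸ t)) (suc i))
  (sym (Listₚ.map-applyUpTo id (λ t → c (i ℕ.∸ t)) (suc i))))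

-- Modulo x^m − 1 the power x^y inverts x^p, so x^{ip} undoes the reversal of the coefficients.
substPow-reversed : ∀ m p y c i → m ∣ p ℕ.+ y →
  xpow-1 m ∣ₚ xpow (i ℕ.* p) *ₚ substPow y (reversed c i) -ₚ lowPart p c i
substPow-reversed m p y c zero    _ = [] , ≋⇒-≋0 (≋-trans (*-oneˡ _ ≋-refl) (substPow-[] y (c 0)))
substPow-reversed m p y c (suc i) m∣p+y
  with substPow-reversed m p y c i m∣p+y | xpow-1-∣ m∣p+y
... | q , e | q′ , e′ = q′ *ₚ (b *ₚ A) +ₚ q , (begin
  xpow (p ℕ.+ i ℕ.* p) *ₚ substPow y (reversed c (suc i)) -ₚ (L +ₚ xpow (p ℕ.+ i ℕ.* p) *ₚ k)
    ≡⟨ cong (λ l → xpow (p ℕ.+ i ℕ.* p) *ₚ substPow y l -ₚ (L +ₚ xpow (p ℕ.+ i ℕ.* p) *ₚ k)) (reversed-suc c i) ⟩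
  xpow (p ℕ.+ i ℕ.* p) *ₚ (k +ₚ xpow y *ₚ A) -ₚ (L +ₚ xpow (p ℕ.+ i ℕ.* p) *ₚ k)
    ≈⟨ cancel (xpow (p ℕ.+ i ℕ.* p)) k (xpow y) A L ⟩
  (xpow (p ℕ.+ i ℕ.* p) *ₚ xpow y) *ₚ A -ₚ L
    ≈⟨ +-congʳ {negₚ L} (*-cong (*-cong (xpow-+ p (i ℕ.* p)) (≋-refl {xpow y})) (≋-refl {A})) ⟩
  ((xpow p *ₚ b) *ₚ xpow y) *ₚ A -ₚ L
    ≈⟨ regroup (xpow p) b (xpow y) A L ⟩
  (xpow p *ₚ xpow y -ₚ one) *ₚ (b *ₚ A) +ₚ (b *ₚ A -ₚ L)
    ≈⟨ +-cong (*-cong (≋-trans (+-congʳ {negₚ one} (≋-sym (xpow-+ p y))) e′) (≋-refl {b *ₚ A})) e ⟩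
  (q′ *ₚ xpow-1 m) *ₚ (b *ₚ A) +ₚ q *ₚ xpow-1 m
    ≈⟨ collect q′ (xpow-1 m) (b *ₚ A) q ⟩
  (q′ *ₚ (b *ₚ A) +ₚ q) *ₚ xpow-1 m ∎)
  where
  open ≋-Reasoning
  A = substPow y (reversed c i)
  L = lowPart p c i
  b = xpow (i ℕ.* p)
  k = [ c (suc i) ]
  cancel : ∀ x k y a l → x *ₚ (k +ₚ y *ₚ a) -ₚ (l +ₚ x *ₚ k) ≋ (x *ₚ y) *ₚ a -ₚ l
  cancel = solve-∀ polyRing
  regroup : ∀ p b y a l → ((p *ₚ b) *ₚ y) *ₚ a -ₚ l ≋ (p *ₚ y -ₚ one) *ₚ (b *ₚ a) +ₚ (b *ₚ a -ₚ l)
  regroup = solve-∀ polyRing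
  collect : ∀ u x v w → (u *ₚ x) *ₚ v +ₚ w *ₚ x ≋ (u *ₚ v +ₚ w) *ₚ x
  collect = solve-∀ polyRing

-- Modulo x^m - 1 the inverse of x^n is x^{n(m-1)}, since their product is x^{nm}.
xpow-cancel-∣ : ∀ m n a → 0 < m → xpow-1 m ∣ₚ xpow n *ₚ a → xpow-1 m ∣ₚ a
xpow-cancel-∣ (suc m) n a _ (q , e) with xpow-1-∣ (∣.n∣m*n n {suc m})
... | q′ , e′ = xpow (n ℕ.* m) *ₚ q -ₚ q′ *ₚ a , (begin
  a
    ≈⟨ split a (xpow (n ℕ.* suc m)) ⟩
  xpow (n ℕ.* suc m) *ₚ a -ₚ xpow-1 (n ℕ.* suc m) *ₚ a
    ≈⟨ +-cong (*-cong power (≋-refl {a})) (-‿cong (*-cong e′ (≋-refl {a}))) ⟩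
  (xpow (n ℕ.* m) *ₚ xpow n) *ₚ a -ₚ (q′ *ₚ M) *ₚ a
    ≈⟨ +-congʳ {negₚ ((q′ *ₚ M) *ₚ a)} (≋-trans (coeffwise (*-assoc (xpow (n ℕ.* m)) (xpow n) a)) (*-cong (≋-refl {xpow (n ℕ.* m)}) e)) ⟩
  xpow (n ℕ.* m) *ₚ (q *ₚ M) -ₚ (q′ *ₚ M) *ₚ a
    ≈⟨ collect (xpow (n ℕ.* m)) q M q′ a ⟩
  (xpow (n ℕ.* m) *ₚ q -ₚ q′ *ₚ a) *ₚ M ∎)
  where
  open ≋-Reasoning
  M = xpow-1 (suc m)
  power : xpow (n ℕ.* suc m) ≋ xpow (n ℕ.* m) *ₚ xpow n
  power rewrite ℕₚ.*-suc n m | ℕₚ.+-comm n (n ℕ.* m) = xpow-+ (n ℕ.* m) n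
  split : ∀ a x → a ≋ x *ₚ a -ₚ (x -ₚ one) *ₚ a
  split = solve-∀ polyRing
  collect : ∀ x q m r a → x *ₚ (q *ₚ m) -ₚ (r *ₚ m) *ₚ a ≋ (x *ₚ q -ₚ r *ₚ a) *ₚ m
  collect = solve-∀ polyRing

-- The block f_{m,p,i,0} and its value

module _ (m p : ℕ) .{{_ : NonZero m}} (pr : Prime p) (m<p : m < p) (i : ℕ) where

  private
    0<m : 0 < m
    0<m = ℕ.>-nonZero⁻¹ m
    cyc = cyclotomic m 0<m
    ip  = i ℕ.* p
    y   = m ℕ.∸ p % m
    M   = Φ m
    F   = Φ (m ℕ.* p)
    b   = xpow m
    a   = xpow ip
    -- The two cuts are Φ_mp = Q + x^{ip} (T + x^m G) and Φ_m(x^p) = L + x^{(i+1)p} H; the block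
    -- sought is T.
    L   = lowPart p (coeff M) i
    T   = take m (drop ip F)
    Q   = take ip F
    H   = substPow p (drop (suc i) M)
    G   = drop m (drop ip F)
    h   = substPow y (w m i)
    θ   = Θ m p i
    v   = quotₚ h M
    ψ   = Ψ m

  xpow-1≋ΨΦ : xpow-1 m ≋ ψ *ₚ M
  xpow-1≋ΨΦ = quotₚ-exact (xpow-1 m) (Φ-Monic cyc) (Φ∣xpow-1 cyc)

  private
    ψ-monic = Monic-factor ψ M (Monic-cong xpow-1≋ΨΦ (xpow-1-Monic m 0<m)) (Φ-Monic cyc)
    degψ    = proj₁ ψ-monic
    degψ+φ≡m : degψ ℕ.+ φ cyc ≡ m
    degψ+φ≡m = proj₁ (proj₂ ψ-monic)
    ψ-Monic : Monic degψ ψ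
    ψ-Monic = proj₂ (proj₂ ψ-monic)

  -- The strict bound, which rests on `φ-positive`, keeps `ψ *ₚ L` below degree ip + m in
  -- `truncated`.
  Below-Ψ : Below m ψ
  Below-Ψ = Below-mono {a = ψ} (subst (degψ <_) degψ+φ≡m (ℕₚ.m<m+n degψ (φ-positive m 0<m))) (degree ψ-Monic)

  p∤m : ¬ p ∣ m
  p∤m p∣m = ℕₚ.<⇒≱ m<p (∣.∣⇒≤ p∣m)

  ΦΦ≋substPow : F *ₚ M ≋ substPow p M
  ΦΦ≋substPow = ≋-sym (≋-trans (Φ-substPow pr m 0<m) (*-cong (≋-refl {F}) (⟦⟧-true (¬? (p ∣? m)) p∤m)))

  -- Truncating Φ_mp · (x^m − 1) = Φ_m(x^p) Ψ_m below x^{ip+m}.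
  truncated : (one -ₚ b) *ₚ Q +ₚ a *ₚ T +ₚ ψ *ₚ L ≋ []
  truncated = ≋-trans W≋Yx (*-zeroˡ-≋ (xpow (ip ℕ.+ m)) Y≋0)
    where
    open ≋-Reasoning
    -- Since m < p, x^{(i+1)p} = x^{p-m} x^m x^{ip}. So all terms beyond the cut are multiples of
    -- x^{ip+m} and are gathered in `Y`; as `W` has smaller degree, `Y` vanishes.
    c = xpow (p ℕ.∸ m)
    W = (one -ₚ b) *ₚ Q +ₚ a *ₚ T +ₚ ψ *ₚ L
    Y = (T +ₚ (b -ₚ one) *ₚ G) -ₚ (ψ *ₚ c) *ₚ H
    F-split : F ≋ Q +ₚ a *ₚ (T +ₚ b *ₚ G)
    F-split = ≋-trans (take-drop ip F) (+-congˡ {Q} (*-cong (≋-refl {a}) (take-drop m (drop ip F))))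
    power : xpow (suc i ℕ.* p) ≋ (c *ₚ b) *ₚ a
    power = ≋-trans (xpow-+ p ip) (*-cong (≋-trans (p-split) (xpow-+ (p ℕ.∸ m) m)) (≋-refl {a}))
      where
      p-split : xpow p ≋ xpow (p ℕ.∸ m ℕ.+ m)
      p-split rewrite ℕₚ.m∸n+n≡m (ℕₚ.<⇒≤ m<p) = ≋-refl
    M-split : substPow p M ≋ L +ₚ ((c *ₚ b) *ₚ a) *ₚ H
    M-split = ≋-trans (substPow-lowPart p M i) (+-congˡ {L} (*-cong power (≋-refl {H})))
    insert : ∀ b q a t s l z → (one -ₚ b) *ₚ q +ₚ a *ₚ t +ₚ s *ₚ l
      ≋ (s *ₚ (l +ₚ z) -ₚ s *ₚ z) -ₚ (b -ₚ one) *ₚ q +ₚ a *ₚ t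
    insert = solve-∀ polyRing
    regroup : ∀ s f m → s *ₚ (f *ₚ m) ≋ (s *ₚ m) *ₚ f
    regroup = solve-∀ polyRing
    collect : ∀ b q a t g s c h →
      ((b -ₚ one) *ₚ (q +ₚ a *ₚ (t +ₚ b *ₚ g)) -ₚ s *ₚ (((c *ₚ b) *ₚ a) *ₚ h)) -ₚ (b -ₚ one) *ₚ q +ₚ a *ₚ t
      ≋ ((t +ₚ (b -ₚ one) *ₚ g) -ₚ (s *ₚ c) *ₚ h) *ₚ (a *ₚ b)
    collect = solve-∀ polyRing
    ψσM : ψ *ₚ (L +ₚ ((c *ₚ b) *ₚ a) *ₚ H) ≋ xpow-1 m *ₚ (Q +ₚ a *ₚ (T +ₚ b *ₚ G))
    ψσM = begin
      ψ *ₚ (L +ₚ ((c *ₚ b) *ₚ a) *ₚ H)         ≈⟨ *-cong (≋-refl {ψ}) (≋-sym (≋-trans ΦΦ≋substPow M-split)) ⟩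
      ψ *ₚ (F *ₚ M)                            ≈⟨ regroup ψ F M ⟩
      (ψ *ₚ M) *ₚ F                            ≈⟨ *-cong (≋-sym xpow-1≋ΨΦ) F-split ⟩
      xpow-1 m *ₚ (Q +ₚ a *ₚ (T +ₚ b *ₚ G))    ∎
    z = ψ *ₚ (((c *ₚ b) *ₚ a) *ₚ H)
    W≋Yx : W ≋ Y *ₚ xpow (ip ℕ.+ m)
    W≋Yx = begin
      W
        ≈⟨ insert b Q a T ψ L (((c *ₚ b) *ₚ a) *ₚ H) ⟩
      (ψ *ₚ (L +ₚ ((c *ₚ b) *ₚ a) *ₚ H) -ₚ z) -ₚ (b -ₚ one) *ₚ Q +ₚ a *ₚ T
        ≈⟨ +-congʳ {a *ₚ T} (+-congʳ {negₚ ((b -ₚ one) *ₚ Q)} (+-congʳ {negₚ z} ψσM)) ⟩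
      ((b -ₚ one) *ₚ (Q +ₚ a *ₚ (T +ₚ b *ₚ G)) -ₚ z) -ₚ (b -ₚ one) *ₚ Q +ₚ a *ₚ T
        ≈⟨ collect b Q a T G ψ c H ⟩
      Y *ₚ (a *ₚ b)
        ≈⟨ *-cong (≋-refl {Y}) (≋-sym (xpow-+ ip m)) ⟩
      Y *ₚ xpow (ip ℕ.+ m) ∎
    Below-W : Below (ip ℕ.+ m) W
    Below-W = Below-+ ((one -ₚ b) *ₚ Q +ₚ a *ₚ T) (ψ *ₚ L) (Below-+ ((one -ₚ b) *ₚ Q) (a *ₚ T)
      (Below-cong {a = Q *ₚ (one -ₚ b)} {(one -ₚ b) *ₚ Q} (coeffwise (*-comm Q (one -ₚ b)))
        (Below-* Q (one -ₚ b) (Below-take ip F)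
          (Below-- one b (Below-mono {a = one} (s≤s z≤n) (degree Monic-one)) (degree (xpow-Monic m)))))
      (subst (λ n → Below n (a *ₚ T)) (ℕₚ.+-comm m ip)
        (Below-cong {a = T *ₚ a} {a *ₚ T} (coeffwise (*-comm T a))
          (Below-* T a (Below-take m (drop ip F)) (degree (xpow-Monic ip))))))
      (subst (λ n → Below n (ψ *ₚ L)) (ℕₚ.+-comm m ip)
        (Below-* ψ L Below-Ψ (Below-lowPart p (coeff M) i)))
    Y≋0 : Y ≋ []
    Y≋0 = small-multiple-zero Y (xpow-Monic (ip ℕ.+ m)) (Below-cong {a = W} W≋Yx Below-W)

  m∣p+y : m ∣ p ℕ.+ y
  m∣p+y = divides (suc (p / m)) (begin
    p ℕ.+ y                                          ≡⟨ cong (ℕ._+ y) (m≡m%n+[m/n]*n p m) ⟩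
    p % m ℕ.+ (p / m) ℕ.* m ℕ.+ y                    ≡⟨ cong (ℕ._+ y) (ℕₚ.+-comm (p % m) _) ⟩
    (p / m) ℕ.* m ℕ.+ p % m ℕ.+ y                    ≡⟨ ℕₚ.+-assoc ((p / m) ℕ.* m) (p % m) y ⟩
    (p / m) ℕ.* m ℕ.+ (p % m ℕ.+ y)                  ≡⟨ cong ((p / m) ℕ.* m ℕ.+_) (ℕₚ.m+[n∸m]≡n (ℕₚ.<⇒≤ (m%n<n p m))) ⟩
    (p / m) ℕ.* m ℕ.+ m                              ≡⟨ ℕₚ.+-comm ((p / m) ℕ.* m) m ⟩
    suc (p / m) ℕ.* m                                ∎)
    where open ≡-Reasoning

  fi0≋ΘΨ : T ≋ θ *ₚ ψ
  fi0≋ΘΨ = -≋0⇒≋ (≋-trans D≋sx (*-zeroˡ-≋ (xpow-1 m) s≋0))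
    where
    open ≋-Reasoning
    A = substPow y (reversed (coeff M) i)
    reversal = substPow-reversed m p y (coeff M) i m∣p+y
    U = proj₁ reversal
    division : h ≋ v *ₚ M +ₚ θ × Below (φ cyc) θ
    division = divMonic-spec h (Φ-Monic cyc)
    x = b -ₚ one
    -- The right side isolates what is known: the vanishing sum of `truncated`, the multiple of x^m
    -- - 1 from `reversal`, the product Ψ_m Φ_m, and the vanishing error of `division`.
    expand : ∀ a b q t s l θ v m A →
      a *ₚ (t -ₚ θ *ₚ s) ≋ ((((one -ₚ b) *ₚ q +ₚ a *ₚ t +ₚ s *ₚ l) +ₚ (b -ₚ one) *ₚ q)
        +ₚ s *ₚ (a *ₚ A -ₚ l)) +ₚ (a *ₚ v *ₚ (s *ₚ m) -ₚ a *ₚ s *ₚ ((v *ₚ m +ₚ θ) -ₚ negₚ A))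
    expand = solve-∀ polyRing
    collect : ∀ a x q s u v → ([] +ₚ x *ₚ q +ₚ s *ₚ (u *ₚ x)) +ₚ (a *ₚ v *ₚ x -ₚ a *ₚ s *ₚ [])
      ≋ (q +ₚ s *ₚ u +ₚ a *ₚ v) *ₚ x
    collect = solve-∀ polyRing
    vanish : (v *ₚ M +ₚ θ) -ₚ negₚ A ≋ []
    vanish = ≋⇒-≋0 (≋-trans (≋-sym (proj₁ division)) (substPow-neg y (reversed (coeff M) i)))
    xD : xpow-1 m ∣ₚ a *ₚ (T -ₚ θ *ₚ ψ)
    xD = Q +ₚ ψ *ₚ U +ₚ a *ₚ v , ≋-trans (expand a b Q T ψ L θ v M A) (≋-trans
      (+-cong (+-cong (+-congʳ {x *ₚ Q} truncated) (*-cong (≋-refl {ψ}) (proj₂ reversal)))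
        (+-cong (*-cong (≋-refl {a *ₚ v}) (≋-sym xpow-1≋ΨΦ)) (-‿cong (*-cong (≋-refl {a *ₚ ψ}) vanish))))
      (collect a x Q ψ U v))
    D∣ = xpow-cancel-∣ m ip (T -ₚ θ *ₚ ψ) 0<m xD
    s = proj₁ D∣
    D≋sx = proj₂ D∣
    -- deg Θ_i < deg Φ_m and deg Φ_m + deg Ψ_m = m, so the product stays below m just as T does.
    Below-D : Below m (T -ₚ θ *ₚ ψ)
    Below-D = Below-- T (θ *ₚ ψ) (Below-take m (drop ip F))
      (subst (λ n → Below n (θ *ₚ ψ)) (trans (ℕₚ.+-comm (φ cyc) degψ) degψ+φ≡m)
        (Below-* θ ψ (proj₂ division) (degree ψ-Monic)))
    s≋0 : s ≋ []
    s≋0 = small-multiple-zero s (xpow-1-Monic m 0<m) (Below-cong {a = T -ₚ θ *ₚ ψ} D≋sx Below-D)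

mainTheorem3 : (m p : ℕ) → .{{_ : NonZero m}} → Prime p → m < p →
    (i : ℕ) → i < totient m →
    fij m p i 0 ≈ₚ Θ m p i *ₚ Ψ m
mainTheorem3 m p pr m<p i _ = at (≋-trans (fij-zero m p i (ℕₚ.<⇒≤ m<p)) (fi0≋ΘΨ m p pr m<p i))
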